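{- Let $G$ be a nice $2$-degenerate graph. Then, for every set $W$ of $|E(G)|+4$ distinct strictly positive integers, there exists an edge-injective neighbour-sum-distinguishing $W$-edge-weighting of $G$. In particular, $\chi^{e,1}_\Sigma(G)\leq |E(G)|+4$.
   Context: All graphs are finite, simple, undirected and loopless. A graph is nice if none of its connected components is isomorphic to $K_2$. A graph is $2$-degenerate if every subgraph has a vertex of degree at most $2$. For a set $W$ of weights, a $W$-edge-weighting of $G$ is a map $w:E(G)\to W$; a $k$-edge-weighting is a $\{1,\dots,k\}$-edge-weighting. For a vertex $v$, $\sigma_w(v)=\sum_{u\in N(v)} w(vu)$. The weighting $w$ is neighbour-sum-distinguishing if $\sigma_w(u)\neq\sigma_w(v)$ for every edge $uv$, and edge-injective if no two distinct edges receive the same weight. For a nice graph $G$, $\chi^{e,1}_\Sigma(G)$ is the smallest $k$ such that $G$ admits an edge-injective neighbour-sum-distinguishing $k$-edge-weighting. -}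

module Defs where

open import Data.Nat using (ℕ; zero; suc; _+_; _≤_; _<_)
open import Data.Bool using (Bool; true; false; if_then_else_; T; _∧_)
open import Data.Fin using (Fin; _<?_)
open import Data.List using (List; map; allFin; length)
open import Data.Nat.ListAction using (sum)
open import Data.List.Membership.Propositional using (_∈_)
open import Data.List.Relation.Unary.All using (All)
open import Data.List.Relation.Unary.Unique.Propositional using (Unique)
open import Data.Product using (Σ; ∃; _×_; _,_)
open import Data.Sum using (_⊎_)
open import Relation.Binary.PropositionalEquality using (_≡_; _≢_)
open import Relation.Nullary using (¬_; does)

record Graph : Set where
  field
    n       : ℕ
    adj     : Fin n → Fin n → Bool
    sym     : ∀ u v → adj u v ≡ adj v u
    irrefl  : ∀ v → adj v v ≡ false
open Graph public

sumFin : (n : ℕ) → (Fin n → ℕ) → ℕ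
sumFin n f = sum (map f (allFin n))

countFin : (n : ℕ) → (Fin n → Bool) → ℕ
countFin n p = sumFin n (λ i → if p i then 1 else 0)

numEdges : Graph → ℕ
numEdges G = sumFin (n G) (λ u → countFin (n G) (λ v → does (u <? v) ∧ adj G u v))

deg : (G : Graph) → Fin (n G) → ℕ
deg G v = countFin (n G) (adj G v)

-- A connected component of G is isomorphic to K₂ iff it consists of two
-- adjacent vertices u ≠ v whose only neighbours are each other.
hasK2Component : Graph → Set
hasK2Component G =
  Σ (Fin (n G)) λ u → Σ (Fin (n G)) λ v →
    T (adj G u v) ×
    (∀ x → T (adj G u x) → x ≡ v) ×
    (∀ x → T (adj G v x) → x ≡ u)

Nice : Graph → Set
Nice G = ¬ hasK2Component G

record Subgraph (G : Graph) : Set where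
  field
    S      : Fin (n G) → Bool
    H      : Fin (n G) → Fin (n G) → Bool
    H-sym  : ∀ u v → H u v ≡ H v u
    H⊆E    : ∀ u v → T (H u v) → T (adj G u v)
    H-ends : ∀ u v → T (H u v) → T (S u) × T (S v)
open Subgraph public

TwoDegenerate : Graph → Set
TwoDegenerate G =
  (K : Subgraph G) → (∃ λ v → T (S K v)) →
  ∃ λ v → T (S K v) × countFin (n G) (H K v) ≤ 2

-- Edge weightings are represented as symmetric functions
-- w : V → V → ℕ; only the values on edges matter.
IsWeighting : (G : Graph) → (Fin (n G) → Fin (n G) → ℕ) → Set
IsWeighting G w = ∀ u v → w u v ≡ w v u

WeightsIn : (G : Graph) → (Fin (n G) → Fin (n G) → ℕ) → (ℕ → Set) → Set
WeightsIn G w W = ∀ u v → T (adj G u v) → W (w u v)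

σ : (G : Graph) → (Fin (n G) → Fin (n G) → ℕ) → Fin (n G) → ℕ
σ G w v = sumFin (n G) (λ u → if adj G v u then w v u else 0)

NeighbourSumDistinguishing : (G : Graph) → (Fin (n G) → Fin (n G) → ℕ) → Set
NeighbourSumDistinguishing G w = ∀ u v → T (adj G u v) → σ G w u ≢ σ G w v

EdgeInjective : (G : Graph) → (Fin (n G) → Fin (n G) → ℕ) → Set
EdgeInjective G w =
  ∀ u v x y → T (adj G u v) → T (adj G x y) → w u v ≡ w x y →
  (u ≡ x × v ≡ y) ⊎ (u ≡ y × v ≡ x)

GoodWeighting : (G : Graph) → (ℕ → Set) → (Fin (n G) → Fin (n G) → ℕ) → Set
GoodWeighting G W w =
  IsWeighting G w × WeightsIn G w W × EdgeInjective G w × NeighbourSumDistinguishing G w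

{-# OPTIONS --safe #-}

-- Induction on the number of edges, for all simple 2-degenerate graphs: edges forming a K₂ component are merely exempt
-- from the condition.  Some edges are deleted, the rest is weighted, and the deleted edges are put back one at a time.
-- Putting back f with weight a changes the difference of the sums at the ends of an edge e only if e and f share exactly
-- one end, and then a single value of a is bad for e; so it suffices to have more unused weights than edges to settle.
-- Two configurations are reducible.
--  (1) A path p c q with deg q ≤ 5 and deg c + deg p ≤ 6: delete cp and cq.
--  (2) A vertex x with at most two neighbours outside a set of leaves, which all have degree at most ℓ + 1.  Delete the
--      star from x to the leaves and weight the rest with the smallest weights; ℓ + 1 of the star edges then get weights
--      exceeding all those of the rest, so the sum at x exceeds that at every leaf.  For ℓ = 1 three leaves suffice.  For ℓ = 2 four
--      leaves suffice if, for some leaf p of degree 3, an edge from p to a vertex of degree at most 2 is deleted as well.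
-- If the set S₁ of vertices of degree at least 3 is empty, (1) applies or the graph is a matching.  Otherwise, let u ∈ S₁
-- have at most two neighbours in S₁.  If it has at least two neighbours outside S₁, (1) or (2) applies at u.  If all such
-- u have only one, they have degree 3; then let S₂ be the set of vertices with at least three neighbours in S₁.
-- If S₂ is empty, (1) applies; if not, some x ∈ S₂ has at most two neighbours in S₂, and (1) or (2) applies at x,
-- according to whether deg x ≤ 5.
module Submission where

open import Defs hiding (S; H) renaming (sym to adj-sym; n to order)
open import Data.Bool using (Bool; true; false; if_then_else_; not; _∧_; T; T?)
open import Data.Empty using (⊥-elim)
open import Data.Fin using (Fin; _≟_; _<?_)
import Data.Fin as Fin
import Data.Fin.Properties as Finₚ
open import Data.List using (List; []; _∷_; _++_; map; length; filter; allFin; cartesianProduct; applyUpTo)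
open import Data.List.Membership.DecPropositional using (_∈?_)
open import Data.List.Membership.Propositional using (_∈_; _∉_)
open import Data.List.Membership.Propositional.Properties using (∈-++⁻; ∈-++⁺ˡ; ∈-++⁺ʳ; ∈-map⁺; ∈-map⁻; ∈-filter⁺; ∈-∃++; ∈-allFin; ∈-cartesianProduct⁺; ∈-applyUpTo⁻)
open import Data.List.Properties using (map-++; length-map; length-++; ++-assoc; filter-++; length-applyUpTo)
open import Data.List.Relation.Binary.Permutation.Propositional using (_↭_; ↭-refl; ↭-sym; ↭-trans; ↭-reflexive; ↭⇒↭ₛ)
open import Data.List.Relation.Binary.Permutation.Propositional.Properties using (↭-length; shift; ∈-resp-↭; All-resp-↭)
import Data.List.Relation.Binary.Permutation.Propositional.Properties as Permₚ
import Data.List.Relation.Binary.Permutation.Setoid.Properties as Permₛ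
open import Data.List.Relation.Unary.All as All using (All; []; _∷_)
import Data.List.Relation.Unary.All.Properties as Allₚ
open import Data.List.Relation.Unary.AllPairs using ([]; _∷_)
open import Data.List.Relation.Unary.Any using (here; there)
open import Data.List.Relation.Unary.Unique.Propositional using (Unique)
import Data.List.Relation.Unary.Unique.Propositional.Properties as Uniqueₚ
open import Data.Nat using (ℕ; zero; suc; _+_; _*_; _≤_; _<_; z≤n; s≤s; ∣_-_∣; _≤?_)
import Data.Nat as ℕ
open import Data.Nat.ListAction using (sum)
open import Data.Nat.ListAction.Properties using (sum-++)
open import Data.Nat.Properties using (+-comm; +-assoc; +-identityʳ; +-cancelˡ-≡; *-distribʳ-+; ≤-refl; ≤-trans; ≤-reflexive; +-mono-≤; m≤m+n; m≤n+m; m+n≡0⇒m≡0; m+n≡0⇒n≡0; ∣m-m+n∣≡n; ∣-∣-comm; ≰⇒>; n<1⇒n≡0; ≤-antisym)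
import Data.Nat.Properties as ℕₚ
open import Data.Nat.Solver using (module +-*-Solver)
open +-*-Solver using (solve; _:+_; _:*_; _:=_; con)
open import Data.Product using (∃; ∃₂; _×_; _,_; proj₁; proj₂)
open import Data.Sum using (_⊎_; inj₁; inj₂)
open import Data.Unit using (⊤; tt)
open import Function using (_∘_)
open import Relation.Binary.Definitions using (tri<; tri≈; tri>)
open import Relation.Binary.PropositionalEquality using (_≡_; _≢_; refl; sym; trans; cong; cong₂; subst; setoid; module ≡-Reasoning)
open import Relation.Nullary using (¬_; Dec; yes; no; does; contradiction)
open import Relation.Nullary.Decidable using (dec-true; dec-false; _×-dec_)

-- Sums over lists, permutations and duplicate-free lists.

module _ {A : Set} where

  total : (A → ℕ) → List A → ℕ
  total g xs = sum (map g xs)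

  total-++ : ∀ g xs ys → total g (xs ++ ys) ≡ total g xs + total g ys
  total-++ g xs ys = trans (cong sum (map-++ g xs ys)) (sum-++ (map g xs) (map g ys))

  total-cong : ∀ {g h} → (∀ x → g x ≡ h x) → ∀ xs → total g xs ≡ total h xs
  total-cong eq []       = refl
  total-cong eq (x ∷ xs) = cong₂ _+_ (eq x) (total-cong eq xs)

  total-mono : ∀ {g h} → (∀ x → g x ≤ h x) → ∀ xs → total g xs ≤ total h xs
  total-mono le []       = z≤n
  total-mono le (x ∷ xs) = +-mono-≤ (le x) (total-mono le xs)

  total-+ : ∀ g h xs → total (λ x → g x + h x) xs ≡ total g xs + total h xs
  total-+ g h []       = refl
  total-+ g h (x ∷ xs) rewrite total-+ g h xs =
    solve 4 (λ a b c d → (a :+ b) :+ (c :+ d) := (a :+ c) :+ (b :+ d)) refl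
      (g x) (h x) (total g xs) (total h xs)

  total-zero : ∀ {g xs} → All (λ x → g x ≡ 0) xs → total g xs ≡ 0
  total-zero []         = refl
  total-zero (eq ∷ eqs) rewrite eq = total-zero eqs

  length-filter≤total : ∀ g xs → length (filter (λ x → g x ℕ.≟ 1) xs) ≤ total g xs
  length-filter≤total g []       = z≤n
  length-filter≤total g (x ∷ xs) with g x
  ... | 0           = length-filter≤total g xs
  ... | 1           = s≤s (length-filter≤total g xs)
  ... | suc (suc m) = ≤-trans (length-filter≤total g xs) (m≤n+m _ (2 + m))

  ∈⇒↭ : ∀ {x : A} {xs} → x ∈ xs → ∃ λ ys → xs ↭ x ∷ ys
  ∈⇒↭ {x} x∈xs with ys , zs , refl ← ∈-∃++ x∈xs = ys ++ zs , shift x ys zs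

  Unique-resp-↭ : ∀ {xs ys : List A} → xs ↭ ys → Unique xs → Unique ys
  Unique-resp-↭ p = Permₛ.Unique-resp-↭ (setoid A) (↭⇒↭ₛ p)

  Unique-++⁻ʳ : ∀ (xs : List A) {ys} → Unique (xs ++ ys) → Unique ys
  Unique-++⁻ʳ []       u       = u
  Unique-++⁻ʳ (x ∷ xs) (_ ∷ u) = Unique-++⁻ʳ xs u

  Unique-++⁻ˡ : ∀ (xs : List A) {ys} → Unique (xs ++ ys) → Unique xs
  Unique-++⁻ˡ []       u       = []
  Unique-++⁻ˡ (x ∷ xs) (a ∷ u) = Allₚ.++⁻ˡ xs a ∷ Unique-++⁻ˡ xs u

∈⇒≤sum : ∀ {x xs} → x ∈ xs → x ≤ sum xs
∈⇒≤sum {xs = y ∷ xs} (here refl) = m≤m+n y (sum xs)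
∈⇒≤sum {xs = y ∷ xs} (there i)   = ≤-trans (∈⇒≤sum i) (m≤n+m _ y)

-- Choosing weights: avoiding forbidden values and splitting off the largest ones.

-- Each forbidden value occurs at most once among the distinct candidates, so it can be discarded at
-- the cost of at most one of them; the surplus leaves an admissible candidate.
pick : ∀ {Fr} → Unique Fr → (K : List ℕ) → length K < length Fr →
       ∃₂ λ a Fr′ → Fr ↭ a ∷ Fr′ × a ∉ K
pick {a ∷ Fr} u [] lt = a , Fr , ↭-refl , λ ()
pick {Fr} u (k ∷ K) lt with _∈?_ ℕ._≟_ k Fr
... | yes k∈Fr
  with Fr₁ , p ← ∈⇒↭ k∈Fr
  with k≢ ∷ u₁ ← Unique-resp-↭ p u
  with a , Fr₂ , q , a∉K ← pick u₁ K (ℕ.s≤s⁻¹ (subst (suc (length K) <_) (↭-length p) lt)) =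
  a , k ∷ Fr₂ ,
  ↭-trans p (↭-trans (_↭_.prep k q) (_↭_.swap k a ↭-refl)) ,
  λ { (here refl) → All.lookup k≢ (∈-resp-↭ (↭-sym q) (here refl)) refl ; (there a∈K) → a∉K a∈K }
... | no k∉Fr
  with a , Fr₁ , p , a∉K ← pick u K (ℕₚ.<-trans (ℕₚ.n<1+n _) lt) =
  a , Fr₁ , p ,
  λ { (here refl) → k∉Fr (∈-resp-↭ (↭-sym p) (here refl)) ; (there a∈K) → a∉K a∈K }

maximum : ∀ x xs → ∃₂ λ m ys → x ∷ xs ↭ m ∷ ys × All (_≤ m) ys
maximum x [] = x , [] , ↭-refl , []
maximum x (y ∷ xs) with maximum y xs
... | m , ys , p , ms with ℕₚ.≤-total x m
... | inj₁ x≤m = m , x ∷ ys , ↭-trans (_↭_.prep x p) (_↭_.swap x m ↭-refl) , x≤m ∷ ms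
... | inj₂ m≤x = x , m ∷ ys , _↭_.prep x p , m≤x ∷ All.map (λ le → ≤-trans le m≤x) ms

largest : ∀ k W → Unique W → k < length W →
  ∃ λ N → ∃₂ λ B W′ → W ↭ B ++ W′ × length B ≡ k × All (suc N ≤_) B × All (_≤ N) W′
-- Maxima are moved from the remaining weights to `B` one at a time. As `k` is less than the number
-- of weights, `W′` is nonempty, so its strict upper bound is positive and has the form `suc N`.
largest k W u k<W with top k (ℕₚ.<⇒≤ k<W)
  where
  top : ∀ k → k ≤ length W → ∃ λ M → ∃₂ λ B W′ → W ↭ B ++ W′ × length B ≡ k × All (M ≤_) B × All (_< M) W′
  -- With nothing split off yet, any number above all weights serves as threshold.
  top zero    le = suc (sum W) , [] , W , ↭-refl , refl , [] , All.tabulate (s≤s ∘ ∈⇒≤sum)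
  top (suc k) le with top k (≤-trans (ℕₚ.n≤1+n k) le)
  ... | M , B , [] , p , refl , bs , ws =
    contradiction (subst (suc (length B) ≤_) (trans (↭-length p) (trans (length-++ B) (+-identityʳ _))) le) ℕₚ.1+n≰n
  ... | M , B , w ∷ W₁ , p , refl , bs , ws with maximum w W₁
  ... | m , W₂ , q , ms with All-resp-↭ q ws
  ... | m<M ∷ _ with Unique-++⁻ʳ B (Unique-resp-↭ p u)
  ... | u₁ with Unique-resp-↭ q u₁
  ... | m≢ ∷ _ =
    -- The maximum `m` is the new threshold; distinctness puts the other remaining weights strictly
    -- below it.
    m , m ∷ B , W₂ ,
    ↭-trans p (↭-trans (Permₚ.++⁺ˡ B q) (shift m B W₂)) , refl ,
    ≤-refl ∷ All.map (≤-trans (ℕₚ.<⇒≤ m<M)) bs ,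
    All.zipWith (λ (le , ne) → ℕₚ.≤∧≢⇒< le (ne ∘ sym)) (ms , m≢)
... | suc N , B , W′     , p , eq , bs , ws     = N , B , W′ , p , eq , bs , All.map ℕ.s≤s⁻¹ ws
... | zero  , B , _ ∷ _  , p , eq , bs , () ∷ _
... | zero  , B , []     , p , refl , bs , ws   =
  contradiction (subst (length B <_) (trans (↭-length p) (trans (length-++ B) (+-identityʳ _))) k<W) ℕₚ.1+n≰n

-- Auxiliary facts on decisions and small sums.

does⁻ : ∀ {P : Set} (P? : Dec P) → does P? ≡ true → P
does⁻ (yes p) _ = p

not-does⁻ : ∀ {P : Set} (P? : Dec P) → not (does P?) ≡ true → ¬ P
not-does⁻ (no ¬p) _ = ¬p

∧-true⁻ : ∀ a {b} → a ∧ b ≡ true → a ≡ true × b ≡ true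
∧-true⁻ true eq = refl , eq

total-cong-∈ : ∀ {A : Set} {g h : A → ℕ} {xs} → All (λ x → g x ≡ h x) xs → total g xs ≡ total h xs
total-cong-∈ []         = refl
total-cong-∈ (eq ∷ eqs) = cong₂ _+_ eq (total-cong-∈ eqs)

total-* : ∀ {A : Set} c (g : A → ℕ) xs → total (λ x → c * g x) xs ≡ c * total g xs
total-* c g []       = sym (ℕₚ.*-zeroʳ c)
total-* c g (x ∷ xs) = trans (cong (c * g x +_) (total-* c g xs)) (sym (ℕₚ.*-distribˡ-+ c (g x) (total g xs)))

total-unique : ∀ {A : Set} (g : A → ℕ) {xs x y} → total g xs ≤ 1 → x ∈ xs → y ∈ xs → 1 ≤ g x → 1 ≤ g y → x ≡ y
total-unique g le (here refl) (here refl) gx gy = refl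
total-unique g le (here refl) (there j)   gx gy =
  contradiction (≤-trans (+-mono-≤ gx (≤-trans gy (∈⇒≤sum (∈-map⁺ g j)))) le) λ { (s≤s ()) }
total-unique g le (there i)   (here refl) gx gy =
  contradiction (≤-trans (+-mono-≤ gy (≤-trans gx (∈⇒≤sum (∈-map⁺ g i)))) le) λ { (s≤s ()) }
total-unique g {z ∷ _} le (there i) (there j) gx gy = total-unique g (≤-trans (m≤n+m _ (g z)) le) i j gx gy

sum≡1 : ∀ m k → m + k ≡ 1 → (m ≡ 1 × k ≡ 0) ⊎ (m ≡ 0 × k ≡ 1)
sum≡1 zero          k eq = inj₂ (refl , eq)
sum≡1 (suc zero)    k eq = inj₁ (refl , ℕₚ.suc-injective eq)

≤1-split : ∀ {m} → m ≤ 1 → m ≡ 0 ⊎ m ≡ 1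
≤1-split {zero}        _ = inj₁ refl
≤1-split {suc zero}    _ = inj₂ refl
≤1-split {suc (suc m)} (s≤s ())

sum≥ : ∀ {N ws} → All (N ≤_) ws → length ws * N ≤ sum ws
sum≥ []         = z≤n
sum≥ (le ∷ les) = +-mono-≤ le (sum≥ les)

-- One summand enters exactly and only the others are estimated: in `dominate` the weight of the
-- edge `xv` has to cancel.
sum≥∈ : ∀ {N k ws ℓ} → All (N ≤_) ws → length ws ≡ suc ℓ → k ∈ ws → k + ℓ * N ≤ sum ws
sum≥∈ (_  ∷ les)    refl (here refl) = +-mono-≤ ≤-refl (sum≥ les)
sum≥∈ {N} {k} {w ∷ w′ ∷ ws} (le ∷ les) refl (there i) =
  ≤-trans (≤-reflexive (solve 3 (λ k N r → k :+ (N :+ r) := N :+ (k :+ r)) refl k N (length ws * N)))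
          (+-mono-≤ le (sum≥∈ les refl i))

transfer : ∀ vs ws {Fr Fr′ : List ℕ} → Fr ↭ vs ++ Fr′ → (vs ++ ws) ++ Fr′ ↭ ws ++ Fr
transfer vs ws {Fr} {Fr′} π = ↭-trans (Permₚ.++-assoc vs ws Fr′)
  (↭-trans (Permₚ.shifts vs ws) (Permₚ.++⁺ˡ ws (↭-sym π)))

-- From the `k` reserved weights and the `f` weights left over by the rest, `a` are spent on star
-- edges. Since `k` exceeds `a` by `ℓ` and `f` is at least 4, at least `ℓ + 4` remain.
starPhase-enough : ∀ {ℓ k m a f g t} → k ≡ m + (suc ℓ + ℓ) → a ≡ m + suc ℓ → 4 ≤ f → t ≡ k + f → t ≡ a + g → ℓ + 4 ≤ g
starPhase-enough {ℓ} {k} {m} {a} {f} {g} {t} refl refl 4≤f eq₁ eq₂ = ℕₚ.+-cancelˡ-≤ (m + suc ℓ) (ℓ + 4) g (begin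
  (m + suc ℓ) + (ℓ + 4)    ≡⟨ solve 2 (λ a b → (a :+ (con 1 :+ b)) :+ (b :+ con 4)
                                            := (a :+ ((con 1 :+ b) :+ b)) :+ con 4) refl m ℓ ⟩
  (m + (suc ℓ + ℓ)) + 4    ≤⟨ ℕₚ.+-monoʳ-≤ (m + (suc ℓ + ℓ)) 4≤f ⟩
  (m + (suc ℓ + ℓ)) + f    ≡⟨ trans (sym eq₁) eq₂ ⟩
  (m + suc ℓ) + g          ∎)
  where open ℕₚ.≤-Reasoning

if-* : ∀ b m → (if b then m else 0) ≡ (if b then 1 else 0) * m
if-* true  m = sym (+-identityʳ m)
if-* false m = refl

T⇒≡ : ∀ b → T b → b ≡ true
T⇒≡ true _ = refl

T-∧⁻ : ∀ a {b} → T (a ∧ b) → T a × T b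
T-∧⁻ true t = tt , t

-- Edges as pairs of vertices, incidences and degrees.

module _ {n : ℕ} where

  Edge : Set
  Edge = Fin n × Fin n

  δ : Fin n → Fin n → ℕ
  δ u v = if does (u ≟ v) then 1 else 0

  δ-refl : ∀ v → δ v v ≡ 1
  δ-refl v rewrite dec-true (v ≟ v) refl = refl

  δ-≢ : ∀ {u v} → u ≢ v → δ u v ≡ 0
  δ-≢ {u} {v} ne rewrite dec-false (u ≟ v) ne = refl

  δ-pos : ∀ {u v} → 1 ≤ δ u v → u ≡ v
  δ-pos {u} {v} le with u ≟ v
  ... | yes eq = eq

  δ-sym : ∀ u v → δ u v ≡ δ v u
  δ-sym u v with u ≟ v
  ... | yes refl = sym (δ-refl u)
  ... | no  ne   = sym (δ-≢ (ne ∘ sym))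

  inc : Fin n → Edge → ℕ
  inc v (a , b) = δ v a + δ v b

  -- For loopless edges this is the number of common ends: 2 if they are parallel, 1 if they share
  -- exactly one end, 0 if they are disjoint.
  meet : Edge → Edge → ℕ
  meet (c , d) e = inc c e + inc d e

  meet-inc : ∀ f x y → meet f (x , y) ≡ inc x f + inc y f
  meet-inc (c , d) x y rewrite δ-sym c x | δ-sym c y | δ-sym d x | δ-sym d y =
    solve 4 (λ p q r s → (p :+ q) :+ (r :+ s) := (p :+ r) :+ (q :+ s)) refl
      (δ x c) (δ y c) (δ x d) (δ y d)

  meet-sym : ∀ e f → meet e f ≡ meet f e
  meet-sym e (x , y) = meet-inc e x y

  deg′ : List Edge → Fin n → ℕ
  deg′ E v = total (inc v) E

  -- Counts an end `v` of the edge only when the opposite end lies in `S`; summed over a simple list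
  -- it gives the number of neighbours of `v` in `S`.
  incIn : (Fin n → Bool) → Fin n → Edge → ℕ
  incIn S v (a , b) = (if S b then δ v a else 0) + (if S a then δ v b else 0)

  degIn : (Fin n → Bool) → List Edge → Fin n → ℕ
  degIn S E v = total (incIn S v) E

  total-meet : ∀ c d E → total (meet (c , d)) E ≡ deg′ E c + deg′ E d
  total-meet c d = total-+ (inc c) (inc d)

  incIn-not : ∀ S v e → incIn S v e + incIn (not ∘ S) v e ≡ inc v e
  incIn-not S v (a , b) with S a | S b
  ... | true  | true  = +-identityʳ _
  ... | true  | false = trans (cong (δ v b +_) (+-identityʳ (δ v a))) (+-comm (δ v b) (δ v a))
  ... | false | true  rewrite +-identityʳ (δ v a) = refl
  ... | false | false = refl

  degIn-not : ∀ S E v → degIn S E v + degIn (not ∘ S) E v ≡ deg′ E v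
  degIn-not S E v = trans (sym (total-+ (incIn S v) (incIn (not ∘ S) v) E)) (total-cong (incIn-not S v) E)

  incIn≤inc : ∀ S v e → incIn S v e ≤ inc v e
  incIn≤inc S v e = subst (incIn S v e ≤_) (incIn-not S v e) (m≤m+n _ _)

  incIn-pos : ∀ S c a b → 1 ≤ incIn S c (a , b) → (c ≡ a × S b ≡ true) ⊎ (c ≡ b × S a ≡ true)
  incIn-pos S c a b le with S b in eqb | 1 ≤? δ c a
  ... | true  | yes p = inj₁ (δ-pos p , refl)
  ... | true  | no ¬p with S a in eqa | 1 ≤? δ c b
  ...   | true  | yes q = inj₂ (δ-pos q , refl)
  ...   | true  | no ¬q rewrite n<1⇒n≡0 (≰⇒> ¬p) | n<1⇒n≡0 (≰⇒> ¬q) = contradiction le λ ()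
  ...   | false | _     rewrite n<1⇒n≡0 (≰⇒> ¬p) = contradiction le λ ()
  incIn-pos S c a b le | false | _ with S a in eqa
  ...   | true  = inj₂ (δ-pos le , refl)

  -- Equality of edge lists as graphs: up to order and orientation.
  infix 4 _≈_
  data _≈_ : List Edge → List Edge → Set where
    []    : [] ≈ []
    keep  : ∀ e {E F} → E ≈ F → e ∷ E ≈ e ∷ F
    flip  : ∀ {a b E} → (a , b) ∷ E ≈ (b , a) ∷ E
    swap  : ∀ {e f E} → e ∷ f ∷ E ≈ f ∷ e ∷ E
    ≈-trans : ∀ {E F G} → E ≈ F → F ≈ G → E ≈ G

  ≈-refl : ∀ {E} → E ≈ E
  ≈-refl {[]}    = []
  ≈-refl {e ∷ E} = keep e ≈-refl

  ≈-sym : ∀ {E F} → E ≈ F → F ≈ E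
  ≈-sym []            = []
  ≈-sym (keep e p)    = keep e (≈-sym p)
  ≈-sym flip          = flip
  ≈-sym swap          = swap
  ≈-sym (≈-trans p q) = ≈-trans (≈-sym q) (≈-sym p)

  ↭⇒≈ : ∀ {E F} → E ↭ F → E ≈ F
  ↭⇒≈ _↭_.refl         = ≈-refl
  ↭⇒≈ (_↭_.prep e p)   = keep e (↭⇒≈ p)
  ↭⇒≈ (_↭_.swap e f p) = ≈-trans swap (keep f (keep e (↭⇒≈ p)))
  ↭⇒≈ (_↭_.trans p q)  = ≈-trans (↭⇒≈ p) (↭⇒≈ q)

  ++-≈ : ∀ P {E F} → E ≈ F → P ++ E ≈ P ++ F
  ++-≈ []      p = p
  ++-≈ (e ∷ P) p = keep e (++-≈ P p)

  total-≈ : ∀ {g} → (∀ a b → g (a , b) ≡ g (b , a)) → ∀ {E F} → E ≈ F → total g E ≡ total g F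
  total-≈ inv []            = refl
  total-≈ {g} inv (keep e p) = cong (g e +_) (total-≈ inv p)
  total-≈ {g} inv (flip {a} {b} {E}) = cong (_+ total g E) (inv a b)
  total-≈ {g} inv (swap {e} {f} {E}) =
    trans (sym (+-assoc (g e) _ _)) (trans (cong (_+ total g E) (+-comm (g e) (g f))) (+-assoc (g f) _ _))
  total-≈ inv (≈-trans p q) = trans (total-≈ inv p) (total-≈ inv q)

  deg-≈ : ∀ {E F} → E ≈ F → ∀ v → deg′ E v ≡ deg′ F v
  deg-≈ p v = total-≈ (λ a b → +-comm (δ v a) (δ v b)) p

  degIn-≈ : ∀ S {E F} → E ≈ F → ∀ v → degIn S E v ≡ degIn S F v
  degIn-≈ S p v = total-≈ (λ a b → +-comm (if S b then δ v a else 0) (if S a then δ v b else 0)) p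

  length-≈ : ∀ {E F} → E ≈ F → length E ≡ length F
  length-≈ []            = refl
  length-≈ (keep e p)    = cong suc (length-≈ p)
  length-≈ flip          = refl
  length-≈ swap          = refl
  length-≈ (≈-trans p q) = trans (length-≈ p) (length-≈ q)

  All-≈ : ∀ {P : Edge → Set} → (∀ {a b} → P (a , b) → P (b , a)) → ∀ {E F} → E ≈ F → All P E → All P F
  All-≈ inv []            ps           = ps
  All-≈ inv (keep e q)    (p ∷ ps)     = p ∷ All-≈ inv q ps
  All-≈ inv flip          (p ∷ ps)     = inv p ∷ ps
  All-≈ inv swap          (p ∷ q ∷ ps) = q ∷ p ∷ ps
  All-≈ inv (≈-trans q r) ps           = All-≈ inv r (All-≈ inv q ps)

  -- Simple and degenerate edge lists.

  Loopless : Edge → Set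
  Loopless (a , b) = a ≢ b

  -- Between loopless edges this excludes exactly parallel ones, whatever their orientation.
  Apart : Edge → Edge → Set
  Apart e f = meet e f ≤ 1

  Simple : List Edge → Set
  Simple []      = ⊤
  Simple (e ∷ E) = Loopless e × All (Apart e) E × Simple E

  Apart-sym : ∀ e f → Apart e f → Apart f e
  Apart-sym e f = subst (_≤ 1) (meet-sym e f)

  Apart-flipˡ : ∀ {a b} f → Apart (a , b) f → Apart (b , a) f
  Apart-flipˡ {a} {b} f = subst (_≤ 1) (+-comm (inc a f) (inc b f))

  Apart-flipʳ : ∀ e {a b} → Apart e (a , b) → Apart e (b , a)
  Apart-flipʳ e {a} {b} = Apart-sym (b , a) e ∘ Apart-flipˡ {a} {b} e ∘ Apart-sym e (a , b)

  Simple-≈ : ∀ {E F} → E ≈ F → Simple E → Simple F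
  Simple-≈ []         s             = s
  Simple-≈ (keep e p) (l , as , s)  = l , All-≈ (λ {a} {b} → Apart-flipʳ e {a} {b}) p as , Simple-≈ p s
  Simple-≈ (flip {a} {b}) (l , as , s) = l ∘ sym , All.map (λ {f} → Apart-flipˡ {a} {b} f) as , s
  Simple-≈ (swap {e} {f}) (l , a ∷ as , m , bs , s) = m , Apart-sym e f a ∷ bs , l , as , s
  Simple-≈ (≈-trans p q) s          = Simple-≈ q (Simple-≈ p s)

  Simple-++⁻ʳ : ∀ F {R} → Simple (F ++ R) → Simple R
  Simple-++⁻ʳ []      s           = s
  Simple-++⁻ʳ (e ∷ F) (_ , _ , s) = Simple-++⁻ʳ F s

  Simple-++⁻ˡ : ∀ F {R} → Simple (F ++ R) → Simple F
  Simple-++⁻ˡ []      s           = tt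
  Simple-++⁻ˡ (e ∷ F) (l , a , s) = l , Allₚ.++⁻ˡ F a , Simple-++⁻ˡ F s

  -- Only induced subgraphs are tested. In this form the property passes to sublists of edges at
  -- once, since every `degIn` can only decrease.
  Degenerate : List Edge → Set
  Degenerate E = ∀ S → (∃ λ v → S v ≡ true) → ∃ λ v → S v ≡ true × degIn S E v ≤ 2

  Degenerate-⊆ : ∀ {E} F {R} → E ≈ F ++ R → Degenerate E → Degenerate R
  Degenerate-⊆ F {R} p dg S ne with v , Sv , le ← dg S ne =
    v , Sv , ≤-trans (m≤n+m _ (degIn S F v)) (subst (_≤ 2) (trans (degIn-≈ S p v) (total-++ _ F R)) le)

  -- Weighted edge lists and the effect of adding an edge.

  WEdge : Set
  WEdge = Edge × ℕ

  edges : List WEdge → List Edge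
  edges = map proj₁

  weights : List WEdge → List ℕ
  weights = map proj₂

  load : List WEdge → Fin n → ℕ
  load X v = total (λ (e , k) → inc v e * k) X

  Settled : List WEdge → Edge → Set
  Settled X (a , b) = load X a ≢ load X b

  -- Exempting isolated edges makes the induction independent of niceness, which deletions do not preserve.
  OK : List WEdge → Edge → Set
  OK X (a , b) = Settled X (a , b) ⊎ (deg′ (edges X) a ≡ 1 × deg′ (edges X) b ≡ 1)

  -- The weight `a` is added to the load of the common end only, so the two loads can become equal
  -- only if `a` is their old distance.
  settle : ∀ X f a e → meet f e ≡ 1 → a ≢ ∣ load X (proj₁ e) - load X (proj₂ e) ∣ → Settled ((f , a) ∷ X) e
  settle X f a (x , y) m ne eq with sum≡1 (inc x f) (inc y f) (trans (sym (meet-inc f x y)) m)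
  ... | inj₁ (p , q) rewrite p | q | +-identityʳ a =
    ne (trans (sym (∣m-m+n∣≡n (load X x) a))
         (cong (∣ load X x -_∣) (trans (+-comm (load X x) a) eq)))
  ... | inj₂ (p , q) rewrite p | q | +-identityʳ a =
    ne (trans (sym (∣m-m+n∣≡n (load X y) a))
         (trans (cong (∣ load X y -_∣) (trans (+-comm (load X y) a) (sym eq))) (∣-∣-comm (load X y) (load X x))))

  -- Adding an edge shifts the loads of its two ends equally.
  settled-self : ∀ X {c d} a → c ≢ d → Settled X (c , d) → Settled (((c , d) , a) ∷ X) (c , d)
  settled-self X {c} {d} a c≢d ne eq
    rewrite δ-refl c | δ-refl d | δ-≢ c≢d | δ-≢ (c≢d ∘ sym) = ne (+-cancelˡ-≡ (a + 0) _ _ eq)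

  OK-away : ∀ X f a e → meet f e ≡ 0 → OK X e → OK ((f , a) ∷ X) e
  OK-away X f a (x , y) m ok
    with p ← m+n≡0⇒m≡0 (inc x f) (trans (sym (meet-inc f x y)) m)
       | q ← m+n≡0⇒n≡0 (inc x f) (trans (sym (meet-inc f x y)) m)
    rewrite p | q = ok

  -- Every edge of `L` forbids a single weight for `f`, so one choice settles all those sharing
  -- exactly one end with `f`.
  step : ∀ X {Fr} f (L : List Edge) → Unique Fr → length L < length Fr →
    ∃₂ λ a Fr′ → Fr ↭ a ∷ Fr′ × (∀ {e} → e ∈ L → meet f e ≡ 1 → Settled ((f , a) ∷ X) e)
  step X {Fr} f L u lt
    with a , Fr′ , p , a∉ ← pick u (map (λ (x , y) → ∣ load X x - load X y ∣) L)
                                 (subst (_< length Fr) (sym (length-map _ L)) lt) =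
    a , Fr′ , p , λ {e} e∈L m → settle X f a e m λ { refl → a∉ (∈-map⁺ _ e∈L) }

  -- Reduction of a path of two edges.

  incˡ : ∀ c q → 1 ≤ inc c (c , q)
  incˡ c q rewrite δ-refl c = s≤s z≤n

  incʳ : ∀ c q → 1 ≤ inc q (c , q)
  incʳ c q rewrite δ-refl q = m≤n+m 1 (δ q c)

  meet-common : ∀ c {p} f → Apart (c , p) f → 1 ≤ inc c f → meet (c , p) f ≡ 1
  meet-common c {p} f ap le = ≤-antisym ap (≤-trans le (m≤m+n _ _))

  -- The edge cq comes first and settles cp and the edges at q; cp then settles cq and every remaining edge at c or p.
  twoEdge : ∀ X {Fr} c p q → All (OK X) (edges X) → Simple ((c , p) ∷ (c , q) ∷ edges X) →
    deg′ (edges X) q ≤ 4 → deg′ (edges X) c + deg′ (edges X) p ≤ 3 → Unique Fr → 6 ≤ length Fr →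
    ∃ λ a → ∃₂ λ b Fr′ → Fr ↭ a ∷ b ∷ Fr′ ×
      (let X′ = ((c , p) , a) ∷ ((c , q) , b) ∷ X in All (OK X′) (edges X′))
  twoEdge X {Fr} c p q oks (c≢p , ap ∷ aps , c≢q , aqs , _) dq dcp u six
    -- Forbidden are one value for `cp` and at most four for the other edges at `q`: five against
    -- six free weights.
    with b , Fr₁ , π₁ , set₁ ← step X (c , q) ((c , p) ∷ filter (λ e → inc q e ℕ.≟ 1) (edges X)) u
           (≤-trans (s≤s (s≤s (≤-trans (length-filter≤total (inc q) (edges X)) dq))) six)
    with _ ∷ u₁ ← Unique-resp-↭ π₁ u
    -- Forbidden are one value for `cq` and at most three for the other edges at `c` or `p`: four
    -- against the five weights left.
    with a , Fr₂ , π₂ , set₂ ← step (((c , q) , b) ∷ X) (c , p) ((c , q) ∷ filter (λ e → meet (c , p) e ℕ.≟ 1) (edges X)) u₁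
           (≤-trans (s≤s (s≤s (≤-trans (length-filter≤total (meet (c , p)) (edges X))
                                       (subst (_≤ 3) (sym (total-meet c p (edges X))) dcp))))
                    (ℕ.s≤s⁻¹ (subst (6 ≤_) (↭-length π₁) six))) =
    a , b , Fr₂ , ↭-trans π₁ (↭-trans (_↭_.prep b π₂) (_↭_.swap b a ↭-refl)) ,
    inj₁ (settled-self (((c , q) , b) ∷ X) a c≢p (set₁ (here refl) (trans (meet-sym (c , q) (c , p)) m))) ∷
    inj₁ (set₂ (here refl) m) ∷
    All.tabulate rest
    where
    m : meet (c , p) (c , q) ≡ 1
    m = meet-common c {p} (c , q) ap (incˡ c q)
    rest : ∀ {e} → e ∈ edges X → OK (((c , p) , a) ∷ ((c , q) , b) ∷ X) e
    rest {e} e∈ with ≤1-split (All.lookup aps e∈)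
    ... | inj₂ m₁ = inj₁ (set₂ (there (∈-filter⁺ _ e∈ m₁)) m₁)
    ... | inj₁ m₀ = OK-away (((c , q) , b) ∷ X) (c , p) a e m₀ ok₁
      where
      -- An edge disjoint from `cp` misses `c`, so it can meet `cq` only at `q` and was taken into
      -- account when `b` was chosen.
      cq : meet (c , q) e ≡ inc q e
      cq = cong (_+ inc q e) (m+n≡0⇒m≡0 (inc c e) m₀)
      ok₁ : OK (((c , q) , b) ∷ X) e
      ok₁ with ≤1-split (All.lookup aqs e∈)
      ... | inj₂ m₁ = inj₁ (set₁ (there (∈-filter⁺ _ e∈ (trans (sym cq) m₁))) m₁)
      ... | inj₁ m₀ = OK-away X (c , q) b e m₀ (All.lookup oks e∈)

  Solution : List Edge → List ℕ → Set
  Solution E W = ∃₂ λ X Fr → edges X ≈ E × weights X ++ Fr ↭ W × All (OK X) (edges X)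

  -- An inequality, because the rest of the graph is weighted from a supply that also contains the
  -- weights meant for the deleted edges.
  Solvable : List Edge → Set
  Solvable E = ∀ W → Unique W → length E + 4 ≤ length W → Solution E W

  length-weights : ∀ X → length (weights X) ≡ length (edges X)
  length-weights X = trans (length-map proj₂ X) (sym (length-map proj₁ X))

  free-length : ∀ X {Fr W R} k → edges X ≈ R → weights X ++ Fr ↭ W → length R + k ≤ length W → k ≤ length Fr
  free-length X {Fr} {W} {R} k p π le = ℕₚ.+-cancelˡ-≤ (length R) k (length Fr)
    (subst (length R + k ≤_) (trans (sym (↭-length π)) (trans (length-++ (weights X))
      (cong (_+ length Fr) (trans (length-weights X) (length-≈ p))))) le)

  -- The deletion lowers the degree of `q` by one and the degree sum of `c` and `p` by three, to the
  -- bounds of `twoEdge`. Two saved weights and four spare ones make up the six that are required.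
  reduceTwo : ∀ {E c p q R} → E ≈ (c , p) ∷ (c , q) ∷ R → Simple E → Solvable R →
    deg′ E q ≤ 5 → deg′ E c + deg′ E p ≤ 6 → Solvable E
  reduceTwo {E} {c} {p} {q} {R} E≈ s sol dq dcp W u le
    with le₁ ← subst (λ m → m + 4 ≤ length W) (length-≈ E≈) le
    with X , Fr , X≈ , π , oks ← sol W u (≤-trans (m≤n+m _ 2) le₁)
    with E≈X ← ≈-trans E≈ (keep (c , p) (keep (c , q) (≈-sym X≈)))
    with a , b , Fr′ , ρ , oks′ ← twoEdge X {Fr} c p q oks (Simple-≈ E≈X s)
      (ℕ.s≤s⁻¹ (≤-trans (+-mono-≤ (incʳ c q) ≤-refl)
        (≤-trans (m≤n+m _ (inc q (c , p))) (subst (_≤ 5) (deg-≈ E≈X q) dq))))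
      (ℕ.s≤s⁻¹ (ℕ.s≤s⁻¹ (ℕ.s≤s⁻¹
        (≤-trans (≤-reflexive (cong suc (cong suc (sym (ℕₚ.+-suc (deg′ (edges X) c) (deg′ (edges X) p))))))
        (≤-trans (+-mono-≤ (+-mono-≤ (incˡ c p) (+-mono-≤ (incˡ c q) (≤-refl {deg′ (edges X) c})))
                           (+-mono-≤ (incʳ c p) (m≤n+m (deg′ (edges X) p) (inc p (c , q)))))
          (subst (_≤ 6) (cong₂ _+_ (deg-≈ E≈X c) (deg-≈ E≈X p)) dcp))))))
      (Unique-++⁻ʳ (weights X) (Unique-resp-↭ (↭-sym π) u))
      (free-length X 6 X≈ π (subst (_≤ length W) (trans (cong (2 +_) (+-comm (length R) 4)) (+-comm 6 (length R))) le₁)) =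
    _ , Fr′ , ≈-sym E≈X , ↭-trans (transfer (a ∷ b ∷ []) (weights X) ρ) π , oks′

  -- Putting back a star.

  star : Fin n → List (Fin n) → List Edge
  star x = map (x ,_)

  -- The edges at the centre `x` stay open while the star grows; they are dealt with once it is
  -- complete.
  OffOK : Fin n → List WEdge → Set
  OffOK x X = ∀ {e} → e ∈ edges X → inc x e ≡ 0 → OK X e

  edges-++ : ∀ Y X {F} → edges Y ≡ F → edges (Y ++ X) ≡ F ++ edges X
  edges-++ Y X eq = trans (map-++ proj₁ Y X) (cong (_++ edges X) eq)

  length-edges : ∀ Y {x vs} → edges Y ≡ star x vs → length Y ≡ length vs
  length-edges Y {x} {vs} eq = trans (sym (length-map proj₁ Y)) (trans (cong length eq) (length-map (x ,_) vs))

  -- An old edge off `x` can meet `xv` only at `v`, so only the old edges at `v` restrict the new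
  -- weight.
  attach : ∀ X {Fr} x v → OffOK x X → All (Apart (x , v)) (edges X) → deg′ (edges X) v < length Fr → Unique Fr →
    ∃₂ λ b Fr′ → Fr ↭ b ∷ Fr′ × OffOK x (((x , v) , b) ∷ X)
  attach X x v off aps lt u
    with b , Fr′ , π , set ← step X (x , v) (filter (λ e → inc v e ℕ.≟ 1) (edges X)) u
           (≤-trans (s≤s (length-filter≤total (inc v) (edges X))) lt) = b , Fr′ , π , off′
    where
    off′ : OffOK x (((x , v) , b) ∷ X)
    off′ (here refl) z = contradiction (subst (1 ≤_) z (incˡ x v)) λ ()
    off′ {e} (there e∈) z with ≤1-split (All.lookup aps e∈)
    ... | inj₂ m₁ = inj₁ (set (∈-filter⁺ _ e∈ (trans (sym (cong (_+ inc v e) z)) m₁)) m₁)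
    ... | inj₁ m₀ = OK-away X (x , v) b e m₀ (off e∈ z)

  grow : ∀ X {Fr} x ℓ vs → OffOK x X → Simple (star x vs ++ edges X) →
    All (λ v → deg′ (star x vs ++ edges X) v ≤ suc ℓ) vs → Unique Fr → length vs + ℓ ≤ length Fr →
    ∃₂ λ Y Fr′ → edges Y ≡ star x vs × Fr ↭ weights Y ++ Fr′ × OffOK x (Y ++ X)
  grow X {Fr} x ℓ []       off s ds u le = [] , Fr , refl , ↭-refl , off
  grow X {Fr} x ℓ (v ∷ vs) off (x≢v , aps , s) (d ∷ ds) u le
    with Y , Fr₁ , eqY , π , off₁ ← grow X {Fr} x ℓ vs off s (All.map (≤-trans (m≤n+m _ _)) ds) u (≤-trans (ℕₚ.n≤1+n _) le)
    with eq ← edges-++ Y X eqY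
    with b , Fr₂ , ρ , off₂ ← attach (Y ++ X) {Fr₁} x v off₁ (subst (All _) (sym eq) aps)
           (≤-trans (≤-trans (+-mono-≤ (incʳ x v) (≤-reflexive (cong (λ E → deg′ E v) eq))) d)
             (ℕₚ.+-cancelˡ-≤ (length vs) (suc ℓ) (length Fr₁)
               (≤-trans (≤-reflexive (ℕₚ.+-suc (length vs) ℓ)) (≤-trans le
                 (≤-reflexive (trans (↭-length π) (trans (length-++ (weights Y))
                   (cong (_+ length Fr₁) (trans (length-map proj₂ Y) (length-edges Y eqY))))))))))
           (Unique-++⁻ʳ (weights Y) (Unique-resp-↭ π u)) =
    ((x , v) , b) ∷ Y , Fr₂ , cong (_ ∷_) eqY ,
    ↭-trans π (↭-trans (Permₚ.++⁺ˡ (weights Y) ρ) (shift b (weights Y) Fr₂)) , off₂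

  -- Dominance of the centre of a star over its leaves.

  load≤ : ∀ X v {N} → All (_≤ N) (weights X) → load X v ≤ deg′ (edges X) v * N
  load≤ []            v []        = z≤n
  load≤ ((e , k) ∷ X) v {N} (le ∷ les) =
    ≤-trans (+-mono-≤ (ℕₚ.*-monoʳ-≤ (inc v e) le) (load≤ X v les))
      (≤-reflexive (sym (*-distribʳ-+ N (inc v e) (deg′ (edges X) v))))

  load-centre : ∀ Z x → All (λ f → inc x f ≡ 1) (edges Z) → load Z x ≡ sum (weights Z)
  load-centre []            x []         = refl
  load-centre ((e , k) ∷ Z) x (eq ∷ eqs) rewrite eq | +-identityʳ k = cong (k +_) (load-centre Z x eqs)

  load-apart : ∀ Z x v → All (Apart (x , v)) (edges Z) → All (λ f → inc x f ≡ 1) (edges Z) → load Z v ≡ 0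
  load-apart []            x v []         []         = refl
  load-apart ((f , _) ∷ Z) x v (ap ∷ aps) (eq ∷ eqs) rewrite eq | n<1⇒n≡0 ap = load-apart Z x v aps eqs

  -- Every other star edge already shares `x` with `xv` and, by simplicity, avoids `v`.
  load-leaf : ∀ Z x v {k} → Simple (edges Z) → All (λ f → inc x f ≡ 1) (edges Z) →
    ((x , v) , k) ∈ Z → load Z v ≡ k
  load-leaf (_ ∷ Z) x v {k} (x≢v , aps , _) (_ ∷ eqs) (here refl)
    rewrite δ-≢ (x≢v ∘ sym) | δ-refl v | +-identityʳ k | load-apart Z x v aps eqs = +-identityʳ k
  load-leaf ((f , j) ∷ Z) x v (_ , aps , s) (eq ∷ eqs) (there i)
    with ap ← Apart-sym f (x , v) (All.lookup aps (∈-map⁺ proj₁ i))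
    rewrite eq | n<1⇒n≡0 ap = load-leaf Z x v s eqs i

  -- The edge xv cancels on both sides; at least ℓ further weights above N remain at x, against at most ℓ weights not above N at v.
  dominate : ∀ X A M x v {ℓ N} → Simple (edges (A ++ M)) → All (λ f → inc x f ≡ 1) (edges (A ++ M)) →
    length M ≡ suc ℓ → All (suc N ≤_) (weights M) → All (_≤ N) (weights X) →
    deg′ (edges ((A ++ M) ++ X)) v ≤ suc ℓ → 1 ≤ ℓ → (x , v) ∈ edges (A ++ M) → Settled ((A ++ M) ++ X) (x , v)
  dominate X A M x v {suc ℓ} {N} s cs len big small d _ xv∈ eq
    with (_ , k) , i , refl ← ∈-map⁻ proj₁ xv∈ =
    ℕₚ.<⇒≢ lt (sym eq)
    where
    open ℕₚ.≤-Reasoning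
    Z = A ++ M
    degX : deg′ (edges X) v ≤ suc ℓ
    degX = ℕ.s≤s⁻¹ (begin
      suc (deg′ (edges X) v)               ≤⟨ +-mono-≤ (≤-trans (incʳ x v) (∈⇒≤sum (∈-map⁺ (inc v) xv∈))) ≤-refl ⟩
      deg′ (edges Z) v + deg′ (edges X) v  ≡⟨ total-++ (inc v) (edges Z) (edges X) ⟨
      deg′ (edges Z ++ edges X) v          ≡⟨ cong (λ E → deg′ E v) (map-++ proj₁ Z X) ⟨
      deg′ (edges (Z ++ X)) v              ≤⟨ d ⟩
      suc (suc ℓ)                          ∎)
    heavy : k + suc ℓ * suc N ≤ sum (weights Z)
    heavy rewrite map-++ proj₂ A M | sum-++ (weights A) (weights M)
      with ∈-++⁻ A i
    ... | inj₁ i∈A = +-mono-≤ (∈⇒≤sum (∈-map⁺ proj₂ i∈A))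
      (≤-trans (ℕₚ.*-monoˡ-≤ (suc N) (≤-trans (ℕₚ.n≤1+n _) (≤-reflexive (sym (trans (length-map proj₂ M) len))))) (sum≥ big))
    ... | inj₂ i∈M = ≤-trans (sum≥∈ big (trans (length-map proj₂ M) len) (∈-map⁺ proj₂ i∈M)) (m≤n+m _ _)
    lt : load (Z ++ X) v < load (Z ++ X) x
    lt = begin-strict
      load (Z ++ X) v             ≡⟨ total-++ _ Z X ⟩
      load Z v + load X v         ≡⟨ cong (_+ load X v) (load-leaf Z x v s cs i) ⟩
      k + load X v                ≤⟨ ℕₚ.+-monoʳ-≤ k (≤-trans (load≤ X v small) (ℕₚ.*-monoˡ-≤ N degX)) ⟩
      -- The inequality is strict because the number of further edges allowed at the leaf is
      -- positive.
      k + suc ℓ * N               <⟨ ℕₚ.+-monoʳ-< k (ℕₚ.*-monoʳ-< (suc ℓ) (ℕₚ.n<1+n N)) ⟩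
      k + suc ℓ * suc N           ≤⟨ heavy ⟩
      sum (weights Z)             ≡⟨ load-centre Z x cs ⟨
      load Z x                    ≤⟨ m≤m+n _ _ ⟩
      load Z x + load X x         ≡⟨ total-++ _ Z X ⟨
      load (Z ++ X) x             ∎

  deg-++ʳ : ∀ F R v → deg′ R v ≤ deg′ (F ++ R) v
  deg-++ʳ F R v = subst (deg′ R v ≤_) (sym (total-++ (inc v) F R)) (m≤n+m _ _)

  star-++ : ∀ x us ms R → star x (us ++ ms) ++ R ≡ star x us ++ star x ms ++ R
  star-++ x us ms R = trans (cong (_++ R) (map-++ (x ,_) us ms)) (++-assoc (star x us) (star x ms) R)

  -- The edges to `ms` come first and draw on `B` alone, which makes their weights large. They use
  -- `ℓ + 1` of its elements; the remaining `length us + ℓ` are already enough for the edges to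
  -- `us`.
  bigStar : ∀ X {B Fr} x ℓ us ms {N} → All (OK X) (edges X) → Simple (star x (us ++ ms) ++ edges X) →
    All (λ v → deg′ (star x (us ++ ms) ++ edges X) v ≤ suc ℓ) (us ++ ms) → Unique (B ++ Fr) →
    length ms ≡ suc ℓ → length us + (suc ℓ + ℓ) ≡ length B → All (suc N ≤_) B →
    ∃ λ A → ∃₂ λ M Fr′ → edges A ≡ star x us × edges M ≡ star x ms × All (suc N ≤_) (weights M) ×
      B ++ Fr ↭ weights (A ++ M) ++ Fr′ × OffOK x ((A ++ M) ++ X)
  bigStar X {B} {Fr} x ℓ us ms oks s ds u lm lB big
    with s₁ ← subst Simple (star-++ x us ms (edges X)) s
    with ds₁ ← subst (λ E → All (λ v → deg′ E v ≤ suc ℓ) (us ++ ms)) (star-++ x us ms (edges X)) ds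
    with M , B₁ , eqM , π , off₁ ← grow X {B} x ℓ ms (λ e∈ _ → All.lookup oks e∈) (Simple-++⁻ʳ (star x us) s₁)
           (All.map (λ {v} → ≤-trans (deg-++ʳ (star x us) _ v)) (Allₚ.++⁻ʳ us ds₁)) (Unique-++⁻ˡ B u)
           (≤-trans (m≤n+m _ (length us)) (≤-reflexive (trans (cong (λ z → length us + (z + ℓ)) lm) lB)))
    with π′ ← ↭-trans (Permₚ.++⁺ʳ Fr π) (Permₚ.++-assoc (weights M) B₁ Fr)
    with A , Fr′ , eqA , ρ , off₂ ← grow (M ++ X) {B₁ ++ Fr} x ℓ us off₁
           (subst (λ E → Simple (star x us ++ E)) (sym (edges-++ M X eqM)) s₁)
           (subst (λ E → All (λ v → deg′ (star x us ++ E) v ≤ suc ℓ) us) (sym (edges-++ M X eqM)) (Allₚ.++⁻ˡ us ds₁))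
           (Unique-++⁻ʳ (weights M) (Unique-resp-↭ π′ u))
           (≤-trans (≤-reflexive (ℕₚ.+-cancelˡ-≡ (suc ℓ) (length us + ℓ) (length B₁)
             (trans (solve 2 (λ a b → (con 1 :+ b) :+ (a :+ b) := a :+ ((con 1 :+ b) :+ b)) refl (length us) ℓ)
             (trans lB (trans (↭-length π) (trans (length-++ (weights M))
               (cong (_+ length B₁) (trans (length-map proj₂ M) (trans (length-edges M eqM) lm)))))))))
             (subst (length B₁ ≤_) (sym (length-++ B₁)) (m≤m+n _ _)))
    = A , M , Fr′ , eqA , eqM , Allₚ.++⁻ˡ (weights M) (All-resp-↭ π big) ,
      ↭-trans π′ (↭-trans (Permₚ.++⁺ˡ (weights M) ρ) (↭-trans (Permₚ.shifts (weights M) (weights A))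
        (↭-reflexive (trans (sym (++-assoc (weights A) (weights M) Fr′))
                            (cong (_++ Fr′) (sym (map-++ proj₂ A M))))))) ,
      subst (OffOK x) (sym (++-assoc A M X)) off₂

  -- Star reductions.

  -- The state in which the star is back except for a last edge `xp`. The field `wins` holds for
  -- every weight `b` of that edge, which leaves `b` free to settle the edges outside the star.
  record StarPhase (x : Fin n) (vs : List (Fin n)) (R : List Edge) (W : List ℕ) (ℓ : ℕ) : Set where
    field
      X Y     : List WEdge
      free    : List ℕ
      X≈R     : edges X ≈ R
      edges-Y : edges Y ≡ star x vs
      covers  : weights (Y ++ X) ++ free ↭ W
      enough  : ℓ + 4 ≤ length free
      off     : OffOK x (Y ++ X)
      wins    : ∀ {p b v} → let Z = ((x , p) , b) ∷ Y in
                Simple (edges Z) → deg′ (edges (Z ++ X)) v ≤ suc ℓ → (x , v) ∈ edges Z → Settled (Z ++ X) (x , v)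

    unique-free : Unique W → Unique free
    unique-free u = Unique-++⁻ʳ (weights (Y ++ X)) (Unique-resp-↭ (↭-sym covers) u)

    edges-YX : edges (Y ++ X) ≡ star x vs ++ edges X
    edges-YX = edges-++ Y X edges-Y

  star-centre : ∀ x vs → Simple (star x vs) → All (λ f → inc x f ≡ 1) (star x vs)
  star-centre x []       _             = []
  star-centre x (v ∷ vs) (x≢v , _ , s) = cong₂ _+_ (δ-refl x) (δ-≢ x≢v) ∷ star-centre x vs s

  edges-star : ∀ x us ms A M → edges A ≡ star x us → edges M ≡ star x ms → edges (A ++ M) ≡ star x (us ++ ms)
  edges-star x us ms A M eqA eqM =
    trans (edges-++ A M eqA) (trans (cong (star x us ++_) eqM) (sym (map-++ (x ,_) us ms)))

  starPhase-wins : ∀ x vs X A M {ℓ N} → edges (A ++ M) ≡ star x vs → length M ≡ suc ℓ → 1 ≤ ℓ →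
    All (suc N ≤_) (weights M) → All (_≤ N) (weights X) →
    ∀ {p b v} → let Z = ((x , p) , b) ∷ A ++ M in
      Simple (edges Z) → deg′ (edges (Z ++ X)) v ≤ suc ℓ → (x , v) ∈ edges Z → Settled (Z ++ X) (x , v)
  starPhase-wins x vs X A M eq lM 1≤ℓ big small {p} {b} {v} s d v∈ =
    dominate X (((x , p) , b) ∷ A) M x v s
      (subst (All (λ f → inc x f ≡ 1)) (sym eq′) (star-centre x (p ∷ vs) (subst Simple eq′ s)))
      lM big small d 1≤ℓ v∈
    where
    eq′ : (x , p) ∷ edges (A ++ M) ≡ star x (p ∷ vs)
    eq′ = cong ((x , p) ∷_) eq

  -- The largest `length us + 2ℓ + 1` weights are reserved and the rest of the graph is solved with
  -- the smaller ones; the threshold between the two is what makes the centre dominate.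
  starPhase : ∀ x us ms {R} ℓ → Solvable R → Simple (star x (us ++ ms) ++ R) →
    All (λ v → deg′ (star x (us ++ ms) ++ R) v ≤ suc ℓ) (us ++ ms) → length ms ≡ suc ℓ → 1 ≤ ℓ →
    ∀ W → Unique W → (length us + (suc ℓ + ℓ)) + (length R + 4) ≤ length W → StarPhase x (us ++ ms) R W ℓ
  starPhase x us ms {R} ℓ sol s ds lm 1≤ℓ W u le =
    split (largest k W u (≤-trans (ℕₚ.m<m+n k (≤-trans (s≤s z≤n) (m≤n+m 4 (length R)))) le))
    where
    k = length us + (suc ℓ + ℓ)
    split : (∃ λ N → ∃₂ λ B W′ → W ↭ B ++ W′ × length B ≡ k × All (suc N ≤_) B × All (_≤ N) W′) →
      StarPhase x (us ++ ms) R W ℓ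
    split (N , B , W′ , π , lB , big , small) = extend (sol W′ (Unique-++⁻ʳ B (Unique-resp-↭ π u)) lW′)
      where
      lW′ : length R + 4 ≤ length W′
      lW′ = ℕₚ.+-cancelˡ-≤ k (length R + 4) (length W′)
        (subst (k + (length R + 4) ≤_) (trans (↭-length π) (trans (length-++ B) (cong (_+ length W′) lB))) le)
      extend : Solution R W′ → StarPhase x (us ++ ms) R W ℓ
      extend (X , Fr , X≈ , ρ , oks) = finish
        (bigStar X {B} {Fr} x ℓ us ms {N} oks (Simple-≈ E≈ s)
          (All.map (λ {v} → subst (_≤ suc ℓ) (deg-≈ E≈ v)) ds)
          (Unique-++⁻ʳ (weights X) (Unique-resp-↭ τ u)) lm (sym lB) big)
        where
        E≈ : star x (us ++ ms) ++ R ≈ star x (us ++ ms) ++ edges X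
        E≈ = ++-≈ (star x (us ++ ms)) (≈-sym X≈)
        τ : W ↭ weights X ++ B ++ Fr
        τ = ↭-trans π (↭-trans (Permₚ.++⁺ˡ B (↭-sym ρ)) (Permₚ.shifts B (weights X)))
        finish : (∃ λ A → ∃₂ λ M Fr′ → edges A ≡ star x us × edges M ≡ star x ms × All (suc N ≤_) (weights M) ×
          B ++ Fr ↭ weights (A ++ M) ++ Fr′ × OffOK x ((A ++ M) ++ X)) → StarPhase x (us ++ ms) R W ℓ
        finish (A , M , Fr′ , eqA , eqM , bigM , υ , off) = record
          { X = X ; Y = A ++ M ; free = Fr′ ; X≈R = X≈ ; edges-Y = eqY
          ; covers = ↭-trans (↭-reflexive (cong (_++ Fr′) (map-++ proj₂ (A ++ M) X)))
                       (↭-trans (transfer (weights (A ++ M)) (weights X) υ) (↭-sym τ))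
          ; enough = starPhase-enough {ℓ} {m = length us} {f = length Fr} {g = length Fr′} lB
              (trans (length-map proj₂ (A ++ M)) (trans (length-edges (A ++ M) eqY)
                (trans (length-++ us) (cong (length us +_) lm))))
              (free-length X 4 X≈ ρ lW′) (length-++ B) (trans (↭-length υ) (length-++ (weights (A ++ M))))
          ; off = off
          ; wins = λ {p} {b} {v} → starPhase-wins x (us ++ ms) X A M eqY (trans (length-edges M eqM) lm) 1≤ℓ bigM
                     (Allₚ.++⁻ˡ (weights X) (All-resp-↭ (↭-sym ρ) small)) {p} {b} {v}
          }
          where
          eqY : edges (A ++ M) ≡ star x (us ++ ms)
          eqY = edges-star x us ms A M eqA eqM

  length-star : ∀ x vs R → length (star x vs ++ R) ≡ length vs + length R
  length-star x vs R = trans (length-++ (star x vs)) (cong (_+ length R) (length-map (x ,_) vs))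

  module _ {x vs R W ℓ} (P : StarPhase x vs R W ℓ) where

    open StarPhase P

    E≈YX : ∀ {E} F → E ≈ F ++ star x vs ++ R → E ≈ F ++ edges (Y ++ X)
    E≈YX {E} F E≈ = subst (λ G → E ≈ F ++ G) (sym edges-YX)
      (≈-trans E≈ (++-≈ F (++-≈ (star x vs) (≈-sym X≈R))))

    ∈-YX : ∀ {e} → e ∈ edges X → e ∈ edges (Y ++ X)
    ∈-YX {e} e∈ = subst (e ∈_) (sym (map-++ proj₁ Y X)) (∈-++⁺ʳ (edges Y) e∈)

    star-settled : ∀ {p b e} → Simple ((x , p) ∷ edges (Y ++ X)) → e ∈ (x , p) ∷ edges Y →
      (∀ {v} → v ∈ p ∷ vs → e ≡ (x , v) → deg′ ((x , p) ∷ edges (Y ++ X)) v ≤ suc ℓ) → Settled (((x , p) , b) ∷ Y ++ X) e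
    star-settled {p} {b} {e} s e∈ d with ∈-map⁻ (x ,_) (subst (e ∈_) (cong ((x , p) ∷_) edges-Y) e∈)
    ... | v , v∈ , refl = wins {p} {b} {v}
      (Simple-++⁻ˡ ((x , p) ∷ edges Y) (subst Simple (cong ((x , p) ∷_) (map-++ proj₁ Y X)) s)) (d v∈ refl) e∈

    base-ok : ∀ {p b e} → All (Apart (x , p)) (edges (Y ++ X)) → e ∈ edges X →
      (meet (x , p) e ≡ 1 → Settled (((x , p) , b) ∷ Y ++ X) e) → OK (((x , p) , b) ∷ Y ++ X) e
    base-ok {p} {b} {e} aps e∈ set with ≤1-split (All.lookup aps (∈-YX e∈))
    ... | inj₂ m₁ = inj₁ (set m₁)
    ... | inj₁ m₀ = OK-away (Y ++ X) (x , p) b e m₀ (off (∈-YX e∈) (m+n≡0⇒m≡0 (inc x e) m₀))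

  -- The weight of `xp` has to settle only the edges outside the star at `x` or `p`, at most two and
  -- one in number. The star edges, `xp` included, are settled by `wins`.
  finishStar : ∀ {E x p vs R W} → StarPhase x vs R W 1 → Unique W → E ≈ star x (p ∷ vs) ++ R → Simple E →
    All (λ v → deg′ E v ≤ 2) (p ∷ vs) → deg′ R x ≤ 2 → Solution E W
  finishStar {E} {x} {p} {vs} {R} {W} P u E≈ s ds dx = finish
    (step (Y ++ X) {free} (x , p) (filter (λ e → meet (x , p) e ℕ.≟ 1) (edges X)) (unique-free u)
      (≤-trans (s≤s (≤-trans (length-filter≤total (meet (x , p)) (edges X))
        (≤-trans (subst (_≤ 3) (sym (total-meet x p (edges X))) degX) (ℕₚ.n≤1+n 3)))) enough))
    where
    open StarPhase P
    E≈Z : E ≈ (x , p) ∷ edges (Y ++ X)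
    E≈Z = E≈YX P ((x , p) ∷ []) E≈
    sZ : Simple ((x , p) ∷ edges (Y ++ X))
    sZ = Simple-≈ E≈Z s
    degX : deg′ (edges X) x + deg′ (edges X) p ≤ 3
    degX = +-mono-≤ (subst (_≤ 2) (sym (deg-≈ X≈R x)) dx)
      (ℕ.s≤s⁻¹ (≤-trans (+-mono-≤ (incʳ x p)
        (subst (λ F → deg′ (edges X) p ≤ deg′ F p) (sym edges-YX) (deg-++ʳ (star x vs) (edges X) p)))
        (subst (_≤ 2) (deg-≈ E≈Z p) (All.head ds))))
    finish : (∃₂ λ b Fr′ → free ↭ b ∷ Fr′ ×
      (∀ {e} → e ∈ filter (λ e → meet (x , p) e ℕ.≟ 1) (edges X) → meet (x , p) e ≡ 1 →
        Settled (((x , p) , b) ∷ Y ++ X) e)) → Solution E W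
    finish (b , Fr , π , set) =
      ((x , p) , b) ∷ Y ++ X , Fr , ≈-sym E≈Z ,
      ↭-trans (transfer (b ∷ []) (weights (Y ++ X)) π) covers ,
      All.tabulate (λ {e} e∈ → ok (∈-++⁻ ((x , p) ∷ edges Y) (subst (e ∈_) (cong ((x , p) ∷_) (map-++ proj₁ Y X)) e∈)))
      where
      ok : ∀ {e} → e ∈ (x , p) ∷ edges Y ⊎ e ∈ edges X → OK (((x , p) , b) ∷ Y ++ X) e
      ok (inj₁ e∈) = inj₁ (star-settled P sZ e∈ λ {v} v∈ _ → subst (_≤ 2) (deg-≈ E≈Z v) (All.lookup ds v∈))
      ok (inj₂ e∈) = base-ok P (proj₁ (proj₂ sZ)) e∈ λ m₁ → set (∈-filter⁺ _ e∈ m₁) m₁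

  -- This is the case `ℓ = 1`: the two leaves `ms` receive the large weights and `p` comes last, so
  -- three leaves are needed.
  reduceStar : ∀ {E x p us ms R} → E ≈ star x (p ∷ us ++ ms) ++ R → Simple E → Solvable R → length ms ≡ 2 →
    All (λ v → deg′ E v ≤ 2) (p ∷ us ++ ms) → deg′ R x ≤ 2 → Solvable E
  reduceStar {E} {x} {p} {us} {ms} {R} E≈ s sol lm ds dx W u le =
    finishStar (starPhase x us ms 1 sol (proj₂ (proj₂ (Simple-≈ E≈ s)))
      (All.map (λ {v} d → ≤-trans (m≤n+m _ _) (subst (_≤ 2) (deg-≈ E≈ v) d)) (All.tail ds)) lm ≤-refl W u
      (≤-trans (≤-reflexive eq) le)) u E≈ s ds dx
    where
    eq : length us + 3 + (length R + 4) ≡ length E + 4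
    eq rewrite length-≈ E≈ | length-star x (us ++ ms) R | length-++ us {ms} | lm =
      solve 2 (λ a b → a :+ con 3 :+ (b :+ con 4) := con 1 :+ ((a :+ con 2) :+ b) :+ con 4) refl (length us) (length R)

  -- First `xp` settles `pv` and the at most two edges outside the star at `x`. Then `pv` settles
  -- the at most three edges at `p` or `v`, `xp` among them. Star edges disjoint from `pv` are
  -- settled by `wins`.
  finishStarTail : ∀ {E x p v vs R W} → StarPhase x vs R W 2 → Unique W → E ≈ (p , v) ∷ star x (p ∷ vs) ++ R → Simple E →
    deg′ E p ≤ 3 → deg′ E v ≤ 2 → All (λ v → deg′ E v ≤ 3) vs → deg′ R x ≤ 2 → Solution E W
  finishStarTail {E} {x} {p} {v} {vs} {R} {W} P u E≈ s dp dv ds dx = next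
    (step (Y ++ X) {free} (x , p) ((p , v) ∷ filter (λ e → inc x e ℕ.≟ 1) (edges X)) (unique-free u)
      (≤-trans (s≤s (s≤s (≤-trans (length-filter≤total (inc x) (edges X))
        (≤-trans (subst (_≤ 2) (sym (deg-≈ X≈R x)) dx) (m≤m+n 2 2))))) enough))
    where
    open StarPhase P
    E≈Z : E ≈ (p , v) ∷ (x , p) ∷ edges (Y ++ X)
    E≈Z = E≈YX P ((p , v) ∷ (x , p) ∷ []) E≈
    sZ : Simple ((p , v) ∷ (x , p) ∷ edges (Y ++ X))
    sZ = Simple-≈ E≈Z s
    m : meet (x , p) (p , v) ≡ 1
    m = trans (meet-sym (x , p) (p , v)) (meet-common p {v} (x , p) (All.head (proj₁ (proj₂ sZ))) (incʳ x p))
    next : (∃₂ λ b Fr₁ → free ↭ b ∷ Fr₁ ×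
      (∀ {e} → e ∈ (p , v) ∷ filter (λ e → inc x e ℕ.≟ 1) (edges X) → meet (x , p) e ≡ 1 →
        Settled (((x , p) , b) ∷ Y ++ X) e)) → Solution E W
    next (b , Fr₁ , π₁ , set₁) = finish
      (step X₁ {Fr₁} (p , v) (filter (λ e → meet (p , v) e ℕ.≟ 1) (edges X₁))
        (Unique-++⁻ʳ (b ∷ []) (Unique-resp-↭ π₁ (unique-free u)))
        (≤-trans (s≤s (≤-trans (length-filter≤total (meet (p , v)) (edges X₁))
          (≤-trans (subst (_≤ 3) (sym (total-meet p v (edges X₁))) deg₁) (ℕₚ.n≤1+n 3))))
          (ℕ.s≤s⁻¹ (subst (6 ≤_) (↭-length π₁) enough))))
      where
      X₁ : List WEdge
      X₁ = ((x , p) , b) ∷ Y ++ X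
      deg₁ : deg′ (edges X₁) p + deg′ (edges X₁) v ≤ 3
      deg₁ = +-mono-≤
        (ℕ.s≤s⁻¹ (≤-trans (+-mono-≤ (incˡ p v) ≤-refl) (subst (_≤ 3) (deg-≈ E≈Z p) dp)))
        (ℕ.s≤s⁻¹ (≤-trans (+-mono-≤ (incʳ p v) ≤-refl) (subst (_≤ 2) (deg-≈ E≈Z v) dv)))
      ok₁ : ∀ {e} → meet (p , v) e ≡ 0 → e ≡ (x , p) ⊎ (e ∈ edges Y ⊎ e ∈ edges X) → OK X₁ e
      ok₁ m₀ (inj₁ refl) = contradiction (subst (1 ≤_) (m+n≡0⇒m≡0 (inc p (x , p)) m₀) (incʳ x p)) λ ()
      ok₁ m₀ (inj₂ (inj₁ e∈)) = inj₁ (star-settled P (proj₂ (proj₂ sZ)) (there e∈) bound)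
        where
        bound : ∀ {z} → z ∈ p ∷ vs → _ ≡ (x , z) → deg′ (edges X₁) z ≤ 3
        bound {z} (here refl) refl = ≤-trans (m≤n+m _ (inc p (p , v))) (subst (_≤ 3) (deg-≈ E≈Z p) dp)
        bound {z} (there z∈)  refl = ≤-trans (m≤n+m _ (inc z (p , v))) (subst (_≤ 3) (deg-≈ E≈Z z) (All.lookup ds z∈))
      ok₁ {e} m₀ (inj₂ (inj₂ e∈)) = base-ok P (proj₁ (proj₂ (proj₂ (proj₂ sZ)))) e∈ λ n₁ →
        set₁ (there (∈-filter⁺ _ e∈ (trans (sym (+-identityʳ _))
          (trans (cong (inc x e +_) (sym (m+n≡0⇒m≡0 (inc p e) m₀))) n₁)))) n₁
      locate : ∀ {e} → e ∈ edges X₁ → e ≡ (x , p) ⊎ (e ∈ edges Y ⊎ e ∈ edges X)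
      locate (here eq)       = inj₁ eq
      locate {e} (there e∈)  = inj₂ (∈-++⁻ (edges Y) (subst (e ∈_) (map-++ proj₁ Y X) e∈))
      finish : (∃₂ λ a Fr₂ → Fr₁ ↭ a ∷ Fr₂ ×
        (∀ {e} → e ∈ filter (λ e → meet (p , v) e ℕ.≟ 1) (edges X₁) → meet (p , v) e ≡ 1 →
          Settled (((p , v) , a) ∷ X₁) e)) → Solution E W
      finish (a , Fr₂ , π₂ , set₂) =
        ((p , v) , a) ∷ X₁ , Fr₂ , ≈-sym E≈Z ,
        ↭-trans (transfer (a ∷ b ∷ []) (weights (Y ++ X))
          (↭-trans π₁ (↭-trans (_↭_.prep b π₂) (_↭_.swap b a ↭-refl)))) covers ,
        inj₁ (settled-self X₁ a (proj₁ sZ) (set₁ (here refl) m)) ∷ All.tabulate ok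
        where
        ok : ∀ {e} → e ∈ edges X₁ → OK (((p , v) , a) ∷ X₁) e
        ok {e} e∈ with ≤1-split (All.lookup (proj₁ (proj₂ sZ)) e∈)
        ... | inj₂ m₁ = inj₁ (set₂ (∈-filter⁺ (λ e → meet (p , v) e ℕ.≟ 1) e∈ m₁) m₁)
        ... | inj₁ m₀ = OK-away X₁ (p , v) a e m₀ (ok₁ m₀ (locate e∈))

  -- Taking pv out as well frees one more weight, which the star with four leaves needs.
  reduceStarTail : ∀ {E x p v us ms R} → E ≈ (p , v) ∷ star x (p ∷ us ++ ms) ++ R → Simple E → Solvable R → length ms ≡ 3 →
    deg′ E p ≤ 3 → deg′ E v ≤ 2 → All (λ v → deg′ E v ≤ 3) (us ++ ms) → deg′ R x ≤ 2 → Solvable E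
  reduceStarTail {E} {x} {p} {v} {us} {ms} {R} E≈ s sol lm dp dv ds dx W u le =
    finishStarTail (starPhase x us ms 2 sol (proj₂ (proj₂ (proj₂ (proj₂ (Simple-≈ E≈ s)))))
      (All.map (λ {z} d → ≤-trans (≤-trans (m≤n+m _ (inc z (x , p))) (m≤n+m _ (inc z (p , v)))) (subst (_≤ 3) (deg-≈ E≈ z) d)) ds)
      lm (s≤s z≤n) W u (≤-trans (≤-reflexive eq) le)) u E≈ s dp dv ds dx
    where
    eq : length us + 5 + (length R + 4) ≡ length E + 4
    eq rewrite length-≈ E≈ | length-star x (us ++ ms) R | length-++ us {ms} | lm =
      solve 2 (λ a b → a :+ con 5 :+ (b :+ con 4) := con 2 :+ ((a :+ con 3) :+ b) :+ con 4) refl (length us) (length R)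

  -- Splitting off the edges from a vertex to a vertex set.

  splitStar : ∀ S c E → ∃₂ λ L R → E ≈ star c L ++ R × All (λ v → S v ≡ true) L × degIn S R c ≡ 0
  splitStar S c [] = [] , [] , [] , [] , refl
  splitStar S c ((a , b) ∷ E) with L , R , E≈ , ss , z ← splitStar S c E with 1 ≤? incIn S c (a , b)
  ... | no lt = L , (a , b) ∷ R ,
    ≈-trans (keep (a , b) E≈) (↭⇒≈ (↭-sym (shift (a , b) (star c L) R))) , ss , cong₂ _+_ (n<1⇒n≡0 (≰⇒> lt)) z
  ... | yes le with incIn-pos S c a b le
  ... | inj₁ (refl , Sb) = b ∷ L , R , keep (c , b) E≈ , Sb ∷ ss , z
  ... | inj₂ (refl , Sa) = a ∷ L , R , ≈-trans flip (keep (c , a) E≈) , Sa ∷ ss , z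

  deg-star : ∀ x vs → Simple (star x vs) → deg′ (star x vs) x ≡ length vs
  deg-star x []       _             = refl
  deg-star x (v ∷ vs) (x≢v , _ , s) = cong₂ _+_ (cong₂ _+_ (δ-refl x) (δ-≢ x≢v)) (deg-star x vs s)

  degIn-++ : ∀ S {E} F {R} → E ≈ F ++ R → ∀ v → degIn S E v ≡ degIn S F v + degIn S R v
  degIn-++ S F {R} E≈ v = trans (degIn-≈ S E≈ v) (total-++ (incIn S v) F R)

  degIn≤star : ∀ S {E} c L {R} → Simple E → E ≈ star c L ++ R → degIn S R c ≡ 0 → degIn S E c ≤ length L
  degIn≤star S {E} c L {R} s E≈ z = begin
    degIn S E c                         ≡⟨ degIn-++ S (star c L) E≈ c ⟩
    degIn S (star c L) c + degIn S R c  ≡⟨ cong (degIn S (star c L) c +_) z ⟩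
    degIn S (star c L) c + 0            ≡⟨ +-identityʳ _ ⟩
    degIn S (star c L) c                ≤⟨ total-mono (incIn≤inc S c) (star c L) ⟩
    deg′ (star c L) c                   ≡⟨ deg-star c L (Simple-++⁻ˡ (star c L) (Simple-≈ E≈ s)) ⟩
    length L                            ∎
    where open ℕₚ.≤-Reasoning

  extract : ∀ S c E → Simple E → 1 ≤ degIn S E c → ∃₂ λ v R → S v ≡ true × E ≈ (c , v) ∷ R
  extract S c E s le with splitStar S c E
  ... | []    , R , E≈ , _      , z = contradiction (≤-trans le (degIn≤star S c [] s E≈ z)) λ ()
  ... | v ∷ L , R , E≈ , Sv ∷ _ , z = v , star c L ++ R , Sv , E≈

  degIn-star-leaf : ∀ S x vs {p} → S x ≡ false → p ≢ x → degIn S (star x vs) p ≡ 0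
  degIn-star-leaf S x []       Sx p≢x = refl
  degIn-star-leaf S x (v ∷ vs) Sx p≢x rewrite Sx | δ-≢ p≢x with S v
  ... | true  = degIn-star-leaf S x vs Sx p≢x
  ... | false = degIn-star-leaf S x vs Sx p≢x

  -- Seen from `p`, a star edge can lead only to the centre `x`, which is not in `S`.
  degIn-outside-star : ∀ S {E} x vs {p R} → E ≈ star x vs ++ R → S x ≡ false → p ≢ x → degIn S R p ≡ degIn S E p
  degIn-outside-star S x vs {p} {R} E≈ Sx p≢x =
    sym (trans (degIn-++ S (star x vs) E≈ p) (cong (_+ degIn S R p) (degIn-star-leaf S x vs Sx p≢x)))

  degIn-split : ∀ S S′ E v → degIn S E v ≤ degIn S′ E v + degIn (λ u → S u ∧ not (S′ u)) E v
  degIn-split S S′ E v = subst (degIn S E v ≤_) (total-+ (incIn S′ v) (incIn (λ u → S u ∧ not (S′ u)) v) E)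
    (total-mono split E)
    where
    half : ∀ s s′ d → (if s then d else 0) ≤ (if s′ then d else 0) + (if s ∧ not s′ then d else 0)
    half false s′    d = z≤n
    half true  true  d = m≤m+n d 0
    half true  false d = ≤-refl
    split : ∀ e → incIn S v e ≤ incIn S′ v e + incIn (λ u → S u ∧ not (S′ u)) v e
    split (a , b) = ≤-trans (+-mono-≤ (half (S b) (S′ b) (δ v a)) (half (S a) (S′ a) (δ v b)))
      (≤-reflexive (solve 4 (λ p q r s → (p :+ q) :+ (r :+ s) := (p :+ r) :+ (q :+ s)) refl
        (if S′ b then δ v a else 0) _ (if S′ a then δ v b else 0) _))

  degIn-++ʳ : ∀ S {E} F {R} → E ≈ F ++ R → ∀ v → degIn S R v ≤ degIn S E v
  degIn-++ʳ S F E≈ v = subst (_ ≤_) (sym (degIn-++ S F E≈ v)) (m≤n+m _ _)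

  deg-rest : ∀ S {E} F {R} c → E ≈ F ++ R → degIn (not ∘ S) R c ≡ 0 → deg′ R c ≤ degIn S E c
  deg-rest S {E} F {R} c E≈ z = begin
    deg′ R c                            ≡⟨ degIn-not S R c ⟨
    degIn S R c + degIn (not ∘ S) R c   ≡⟨ cong (degIn S R c +_) z ⟩
    degIn S R c + 0                     ≡⟨ +-identityʳ _ ⟩
    degIn S R c                         ≤⟨ degIn-++ʳ S F E≈ c ⟩
    degIn S E c                         ∎
    where open ℕₚ.≤-Reasoning

  star-rotate : ∀ x p us ms R → star x (p ∷ ms ++ us) ++ R ≈ star x (p ∷ us ++ ms) ++ R
  star-rotate x p us ms R = ↭⇒≈ (Permₚ.++⁺ʳ R (Permₚ.map⁺ (x ,_) (_↭_.prep p (Permₚ.++-comm ms us))))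

  -- Finding a reducible configuration.

  -- Every edge is isolated and hence exempt, so any free weight will do.
  reduceMatching : ∀ E → Simple E → (∀ v → deg′ E v ≤ 1) →
    (∀ {R} F → E ≈ F ++ R → 1 ≤ length F → Solvable R) → Solvable E
  reduceMatching []            s d₁ rec W u le = [] , W , [] , ↭-refl , []
  reduceMatching ((a , b) ∷ R) s d₁ rec W u le
    with X , Fr , X≈ , π , oks ← rec ((a , b) ∷ []) ≈-refl ≤-refl W u (≤-trans (ℕₚ.n≤1+n _) le)
    with Fr | π | free-length X 5 X≈ π (≤-trans (≤-reflexive (ℕₚ.+-suc (length R) 4)) le)
  ... | k ∷ Fr′ | π′ | _ = ((a , b) , k) ∷ X , Fr′ , keep (a , b) X≈ ,
    ↭-trans (↭-sym (shift k (weights X) Fr′)) π′ ,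
    inj₂ (once a (incˡ a b) , once b (incʳ a b)) ∷
    All.tabulate (λ {e} e∈ → OK-away X (a , b) k e (cong₂ _+_ (away a (incˡ a b) e∈) (away b (incʳ a b) e∈)) (All.lookup oks e∈))
    where
    degX : ∀ v → inc v (a , b) + deg′ (edges X) v ≤ 1
    degX v = subst (λ z → inc v (a , b) + z ≤ 1) (sym (deg-≈ X≈ v)) (d₁ v)
    once : ∀ v → 1 ≤ inc v (a , b) → inc v (a , b) + deg′ (edges X) v ≡ 1
    once v le = ≤-antisym (degX v) (≤-trans le (m≤m+n _ _))
    away : ∀ v {e} → 1 ≤ inc v (a , b) → e ∈ edges X → inc v e ≡ 0
    away v {e} le e∈ = ℕₚ.n≤0⇒n≡0 (≤-trans (∈⇒≤sum (∈-map⁺ (inc v) e∈))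
      (ℕ.s≤s⁻¹ (≤-trans (+-mono-≤ le (≤-refl {deg′ (edges X) v})) (degX v))))

  reduce : ∀ E → Simple E → Degenerate E → (∀ {R} F → E ≈ F ++ R → 1 ≤ length F → Solvable R) → Solvable E
  reduce E s dg rec with Finₚ.any? (λ v → 3 ≤? deg′ E v)
  ... | no none₃ = small (Finₚ.any? (λ v → 2 ≤? deg′ E v))
    where
    d₂ : ∀ v → deg′ E v ≤ 2
    d₂ v = ℕ.s≤s⁻¹ (≰⇒> λ le → none₃ (v , le))
    small : Dec (∃ λ v → 2 ≤ deg′ E v) → Solvable E
    small (no none₂) = reduceMatching E s (λ v → ℕ.s≤s⁻¹ (≰⇒> λ le → none₂ (v , le))) rec
    small (yes (c , 2≤)) with splitStar (λ _ → true) c E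
    ... | []         , R , E≈ , _ , z = contradiction (≤-trans 2≤ (degIn≤star (λ _ → true) c [] s E≈ z)) λ ()
    ... | p ∷ []     , R , E≈ , _ , z = contradiction (≤-trans 2≤ (degIn≤star (λ _ → true) c (p ∷ []) s E≈ z)) λ { (s≤s ()) }
    ... | p ∷ q ∷ L  , R , E≈ , _ , z = reduceTwo E≈ s (rec (star c (p ∷ q ∷ [])) E≈ (s≤s z≤n))
      (≤-trans (d₂ q) (m≤m+n 2 3)) (≤-trans (+-mono-≤ (d₂ c) (d₂ p)) (m≤m+n 4 2))
  ... | yes (v₃ , 3≤v₃) = large (Finₚ.any? λ u → (3 ≤? deg′ E u) ×-dec ((degIn S₁ E u ≤? 2) ×-dec (2 ≤? degIn D E u)))
    where
    S₁ D S₂ S₁₂ : Fin n → Bool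
    S₁ v = does (3 ≤? deg′ E v)
    D = not ∘ S₁
    S₂ v = does (3 ≤? degIn S₁ E v)
    S₁₂ v = S₁ v ∧ not (S₂ v)
    D⁻ : ∀ v → D v ≡ true → deg′ E v ≤ 2
    D⁻ v Dv = ℕ.s≤s⁻¹ (≰⇒> (not-does⁻ (3 ≤? deg′ E v) Dv))
    S₁-D : ∀ v → 3 ≤ deg′ E v → D v ≡ false
    S₁-D v le = cong not (dec-true (3 ≤? deg′ E v) le)
    S₁₂⁻ : ∀ v → S₁₂ v ≡ true → 3 ≤ deg′ E v × degIn S₁ E v ≤ 2
    S₁₂⁻ v eq = let eq₁ , eq₂ = ∧-true⁻ (S₁ v) eq in
      does⁻ (3 ≤? deg′ E v) eq₁ , ℕ.s≤s⁻¹ (≰⇒> (not-does⁻ (3 ≤? degIn S₁ E v) eq₂))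

    large : Dec (∃ λ u → 3 ≤ deg′ E u × degIn S₁ E u ≤ 2 × 2 ≤ degIn D E u) → Solvable E
    large (yes (u , 3≤ , low , 2≤)) with splitStar D u E
    ... | []                , R , E≈ , _ , z = contradiction (≤-trans 2≤ (degIn≤star D u [] s E≈ z)) λ ()
    ... | p ∷ []            , R , E≈ , _ , z = contradiction (≤-trans 2≤ (degIn≤star D u (p ∷ []) s E≈ z)) λ { (s≤s ()) }
    -- Exactly two neighbours outside `S₁` and at most two inside bound the degree of `u` by 4, so
    -- the path reduction applies.
    ... | p ∷ q ∷ []        , R , E≈ , Dp ∷ Dq ∷ _ , z =
      reduceTwo E≈ s (rec (star u (p ∷ q ∷ [])) E≈ (s≤s z≤n)) (≤-trans (D⁻ q Dq) (m≤m+n 2 3)) (+-mono-≤ du (D⁻ p Dp))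
      where
      du : deg′ E u ≤ 4
      du = subst (_≤ 4) (sym (trans (deg-≈ E≈ u) (total-++ (inc u) (star u (p ∷ q ∷ [])) R)))
        (+-mono-≤ (≤-reflexive (deg-star u (p ∷ q ∷ []) (Simple-++⁻ˡ (star u (p ∷ q ∷ [])) (Simple-≈ E≈ s))))
          (≤-trans (deg-rest S₁ (star u (p ∷ q ∷ [])) u E≈ z) low))
    -- Three or more leaves of degree at most 2, and at most two further edges at `u`: the star
    -- reduction with `ℓ = 1`.
    ... | p ∷ q ∷ r ∷ us    , R , E≈ , Dp ∷ Dq ∷ Dr ∷ Ds , z =
      reduceStar {us = us} {ms = q ∷ r ∷ []} (≈-trans E≈ (star-rotate u p us (q ∷ r ∷ []) R)) s
        (rec (star u (p ∷ q ∷ r ∷ us)) E≈ (s≤s z≤n)) refl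
        (All.map (λ {w} → D⁻ w) (Dp ∷ Allₚ.++⁺ Ds (Dq ∷ Dr ∷ [])))
        (≤-trans (deg-rest S₁ (star u (p ∷ q ∷ r ∷ us)) u E≈ z) low)
    large (no none) = deep (Finₚ.any? (λ v → 3 ≤? degIn S₁ E v))
      where
      degD≤1 : ∀ u → 3 ≤ deg′ E u → degIn S₁ E u ≤ 2 → degIn D E u ≤ 1
      degD≤1 u 3≤ low = ℕ.s≤s⁻¹ (≰⇒> λ 2≤ → none (u , 3≤ , low , 2≤))
      -- From here on, a vertex of `S₁` with at most two neighbours in `S₁` has exactly one
      -- neighbour in `D` and degree 3.
      deg≤3 : ∀ u → degIn S₁ E u ≤ 2 → deg′ E u ≤ 3
      deg≤3 u low with 3 ≤? deg′ E u
      ... | yes 3≤ = subst (_≤ 3) (degIn-not S₁ E u) (+-mono-≤ low (degD≤1 u 3≤ low))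
      ... | no  3≰ = ℕₚ.<⇒≤ (≰⇒> 3≰)
      1≤degD : ∀ u → 3 ≤ deg′ E u → degIn S₁ E u ≤ 2 → 1 ≤ degIn D E u
      1≤degD u 3≤ low = ℕₚ.+-cancelˡ-≤ 2 1 (degIn D E u)
        (≤-trans (subst (3 ≤_) (sym (degIn-not S₁ E u)) 3≤) (ℕₚ.+-monoˡ-≤ (degIn D E u) low))
      1≤degS₁ : ∀ u → 3 ≤ deg′ E u → degIn S₁ E u ≤ 2 → 1 ≤ degIn S₁ E u
      1≤degS₁ u 3≤ low = ℕₚ.+-cancelʳ-≤ 2 1 (degIn S₁ E u)
        (≤-trans (subst (3 ≤_) (sym (degIn-not S₁ E u)) 3≤)
          (ℕₚ.+-monoʳ-≤ (degIn S₁ E u) (≤-trans (degD≤1 u 3≤ low) (ℕₚ.n≤1+n 1))))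

      -- The neighbour `v` of `c` in `D` completes the path `v c y`; the degree sum of `c` and `v`
      -- is at most 3 + 2.
      viaTwo : ∀ {c y R} → E ≈ (c , y) ∷ R → 3 ≤ deg′ E c → degIn S₁ E c ≤ 2 → 3 ≤ deg′ E y → deg′ E y ≤ 5 → Solvable E
      viaTwo {c} {y} {R} E≈ 3≤c low 3≤y y≤5
        with s₁@(c≢y , _ , sR) ← Simple-≈ E≈ s
        with v , R₂ , Dv , R≈ ← extract D c R sR (subst (1 ≤_)
               (sym (degIn-outside-star D y (c ∷ []) (≈-trans E≈ flip) (S₁-D y 3≤y) c≢y)) (1≤degD c 3≤c low)) =
        reduceTwo E≈₂ s (rec ((c , v) ∷ (c , y) ∷ []) E≈₂ (s≤s z≤n)) y≤5
          (≤-trans (+-mono-≤ (deg≤3 c low) (D⁻ v Dv)) (ℕₚ.n≤1+n 5))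
        where
        E≈₂ : E ≈ (c , v) ∷ (c , y) ∷ R₂
        E≈₂ = ≈-trans E≈ (≈-trans (keep (c , y) R≈) swap)

      -- All neighbours of `x` outside `S₂` serve as leaves; they have degree at most 3, and there
      -- are at least 6 - 2 = 4 of them. The leaf `p` lies in `S₁`, so it has a neighbour `v` in `D`
      -- that provides the extra edge `pv`.
      viaStar : ∀ {x p R₁} → E ≈ (x , p) ∷ R₁ → S₁₂ p ≡ true → 6 ≤ deg′ E x → degIn S₂ E x ≤ 2 → Solvable E
      viaStar {x} {p} {R₁} E≈ Sp 6≤ low₂
        with x≢p , _ , sR₁ ← Simple-≈ E≈ s
        with L , R , R₁≈ , ss , z ← splitStar (not ∘ S₂) x R₁
        with E≈R ← ≈-trans E≈ (keep (x , p) R₁≈)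
        with v , R₂ , Dv , R≈ ← extract D p R (Simple-++⁻ʳ (star x (p ∷ L)) (Simple-≈ E≈R s)) (subst (1 ≤_)
               (sym (degIn-outside-star D x (p ∷ L) E≈R (S₁-D x (≤-trans (m≤m+n 3 3) 6≤)) (x≢p ∘ sym)))
               (1≤degD p (proj₁ (S₁₂⁻ p Sp)) (proj₂ (S₁₂⁻ p Sp)))) =
        leaves L ss E≈R (≤-trans (deg-rest S₂ (star x (p ∷ L)) x E≈R z) low₂)
        where
        leaves : ∀ L → All (λ v → not (S₂ v) ≡ true) L → E ≈ star x (p ∷ L) ++ R → deg′ R x ≤ 2 → Solvable E
        leaves L ss E≈R dR = go L ss E≈R (ℕₚ.+-cancelʳ-≤ 2 4 (suc (length L)) (≤-trans 6≤ (≤-trans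
          (≤-reflexive (trans (deg-≈ E≈R x) (trans (total-++ (inc x) (star x (p ∷ L)) R)
            (cong (_+ deg′ R x) (deg-star x (p ∷ L) (Simple-++⁻ˡ (star x (p ∷ L)) (Simple-≈ E≈R s)))))))
          (ℕₚ.+-monoʳ-≤ (suc (length L)) dR))))
          where
          go : ∀ L → All (λ v → not (S₂ v) ≡ true) L → E ≈ star x (p ∷ L) ++ R → 4 ≤ suc (length L) → Solvable E
          go (a ∷ b ∷ c ∷ us) (Sa ∷ Sb ∷ Sc ∷ Ss) E≈R _ =
            reduceStarTail {us = us} {ms = a ∷ b ∷ c ∷ []} E≈₃ s (rec ((p , v) ∷ star x (p ∷ us ++ a ∷ b ∷ c ∷ [])) E≈₃ (s≤s z≤n)) refl
              (deg≤3 p (proj₂ (S₁₂⁻ p Sp))) (D⁻ v Dv)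
              (All.map (λ {w} Sw → deg≤3 w (ℕ.s≤s⁻¹ (≰⇒> (not-does⁻ (3 ≤? degIn S₁ E w) Sw)))) (Allₚ.++⁺ Ss (Sa ∷ Sb ∷ Sc ∷ [])))
              (≤-trans (≤-trans (m≤n+m _ (inc x (p , v))) (≤-reflexive (sym (deg-≈ R≈ x)))) dR)
            where
            E≈₃ : E ≈ (p , v) ∷ star x (p ∷ us ++ a ∷ b ∷ c ∷ []) ++ R₂
            E≈₃ = ≈-trans E≈R (≈-trans (++-≈ (star x (p ∷ a ∷ b ∷ c ∷ us)) R≈)
              (≈-trans (↭⇒≈ (shift (p , v) (star x (p ∷ a ∷ b ∷ c ∷ us)) R₂))
                (keep (p , v) (star-rotate x p us (a ∷ b ∷ c ∷ []) R₂))))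
          go []           _ _ (s≤s ())
          go (_ ∷ [])     _ _ (s≤s (s≤s ()))
          go (_ ∷ _ ∷ []) _ _ (s≤s (s≤s (s≤s ())))

      deep : Dec (∃ λ v → 3 ≤ degIn S₁ E v) → Solvable E
      -- If `S₂` is empty, `v₃` and any neighbour of it in `S₁` both have degree at most 3.
      deep (no none₂) = flat (extract S₁ v₃ E s (1≤degS₁ v₃ 3≤v₃ (all-low v₃)))
        where
        all-low : ∀ u → degIn S₁ E u ≤ 2
        all-low u = ℕ.s≤s⁻¹ (≰⇒> λ le → none₂ (u , le))
        flat : (∃₂ λ y R → S₁ y ≡ true × E ≈ (v₃ , y) ∷ R) → Solvable E
        flat (y , R , Sy , E≈) = viaTwo E≈ 3≤v₃ (all-low v₃) (does⁻ (3 ≤? deg′ E y) Sy) (≤-trans (deg≤3 y (all-low y)) (m≤m+n 3 2))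
      deep (yes (z , 3≤z))
        -- Degeneracy is applied to `S₂`: of the at least three neighbours of `x` in `S₁` at most
        -- two lie in `S₂`, which leaves some `p` in `S₁₂`.
        with x , S₂x , low₂ ← dg S₂ (z , dec-true (3 ≤? degIn S₁ E z) 3≤z)
        with 3≤x ← does⁻ (3 ≤? degIn S₁ E x) S₂x
        with p , R , Sp , E≈ ← extract S₁₂ x E s (ℕₚ.+-cancelˡ-≤ 2 1 (degIn S₁₂ E x)
               (≤-trans 3≤x (≤-trans (degIn-split S₁ S₂ E x) (ℕₚ.+-monoˡ-≤ (degIn S₁₂ E x) low₂))))
        with deg′ E x ≤? 5
      ... | yes x≤5 = viaTwo (≈-trans E≈ flip) (proj₁ (S₁₂⁻ p Sp)) (proj₂ (S₁₂⁻ p Sp))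
              (≤-trans 3≤x (total-mono (incIn≤inc S₁ x) E)) x≤5
      ... | no  x≰5 = viaStar E≈ Sp (≰⇒> x≰5) low₂

  solvable : ∀ m E → length E ≤ m → Simple E → Degenerate E → Solvable E
  solvable zero    []      _  s dg W u le = [] , W , [] , ↭-refl , []
  solvable (suc m) E       lE s dg = reduce E s dg λ {R} F E≈ 1≤F →
    solvable m R (ℕ.s≤s⁻¹ (≤-trans (+-mono-≤ 1≤F (≤-refl {length R}))
                   (≤-trans (≤-reflexive (sym (trans (length-≈ E≈) (length-++ F)))) lE)))
      (Simple-++⁻ʳ F (Simple-≈ E≈ s)) (Degenerate-⊆ F E≈ dg)

  -- From weighted edge lists to symmetric weight functions.

  total-δ : ∀ (h : Fin n → ℕ) b {xs} → Unique xs → b ∈ xs → total (λ u → h u * δ u b) xs ≡ h b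
  total-δ h b {x ∷ xs} (x≢ ∷ u) (here refl) rewrite δ-refl b =
    trans (cong (h b * 1 +_) (total-zero (All.map (λ {z} b≢z → trans (cong (h z *_) (δ-≢ (b≢z ∘ sym))) (ℕₚ.*-zeroʳ (h z))) x≢)))
      (trans (+-identityʳ _) (ℕₚ.*-identityʳ (h b)))
  total-δ h b {x ∷ xs} (x≢ ∷ u) (there i)
    rewrite δ-≢ (All.lookup x≢ i) | ℕₚ.*-zeroʳ (h x) = total-δ h b u i

  -- For a loopless edge this is 1 if it joins `u` and `v`, in either orientation, and 0 otherwise.
  mult : Fin n → Fin n → Edge → ℕ
  mult u v (a , b) = δ u a * δ v b + δ u b * δ v a

  mult-sym : ∀ u v e → mult u v e ≡ mult v u e
  mult-sym u v (a , b) = solve 4 (λ p q r s → p :* q :+ r :* s := s :* r :+ q :* p) refl (δ u a) (δ v b) (δ u b) (δ v a)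

  mult-self : ∀ {a b} → a ≢ b → mult a b (a , b) ≡ 1
  mult-self {a} {b} a≢b rewrite δ-refl a | δ-refl b | δ-≢ a≢b = refl

  mult-apart : ∀ a b f → Apart (a , b) f → mult a b f ≡ 0
  mult-apart a b (c , d) = products (δ a c) (δ a d) (δ b c) (δ b d)
    where
    -- At most one of the four numbers is nonzero, whereas a nonzero product would need two.
    products : ∀ p q r s → (p + q) + (r + s) ≤ 1 → p * s + q * r ≡ 0
    products zero    zero    r       s       _ = refl
    products zero    (suc q) zero    s       _ = ℕₚ.*-zeroʳ q
    products zero    (suc q) (suc r) s       (s≤s le) with q + suc (r + s) | ℕₚ.+-suc q (r + s)
    products zero    (suc q) (suc r) s       (s≤s ()) | _ | refl
    products (suc p) q       r       s       (s≤s le)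
      with e ← ℕₚ.n≤0⇒n≡0 le
      rewrite m+n≡0⇒n≡0 r (m+n≡0⇒n≡0 (p + q) e) | m+n≡0⇒n≡0 p (m+n≡0⇒m≡0 (p + q) e) =
      trans (+-identityʳ _) (ℕₚ.*-zeroʳ p)

  mult-pos : ∀ u v a b → 1 ≤ mult u v (a , b) → (u ≡ a × v ≡ b) ⊎ (u ≡ b × v ≡ a)
  mult-pos u v a b le with u ≟ a | v ≟ b
  ... | yes p | yes q = inj₁ (p , q)
  ... | yes p | no  _ with u ≟ b | v ≟ a
  ...   | yes r | yes s = inj₂ (r , s)
  mult-pos u v a b le | no _ | _ with u ≟ b | v ≟ a
  ...   | yes r | yes s = inj₂ (r , s)

  total-mult : ∀ (h : Fin n → ℕ) v a b → total (λ u → h u * mult v u (a , b)) (allFin n) ≡ δ v a * h b + δ v b * h a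
  total-mult h v a b = begin
    total (λ u → h u * mult v u (a , b)) (allFin n)
      ≡⟨ total-cong (λ u → solve 5 (λ h p q r s → h :* (p :* q :+ r :* s) := p :* (h :* q) :+ r :* (h :* s)) refl
           (h u) (δ v a) (δ u b) (δ v b) (δ u a)) (allFin n) ⟩
    total (λ u → δ v a * (h u * δ u b) + δ v b * (h u * δ u a)) (allFin n)
      ≡⟨ total-+ (λ u → δ v a * (h u * δ u b)) (λ u → δ v b * (h u * δ u a)) (allFin n) ⟩
    total (λ u → δ v a * (h u * δ u b)) (allFin n) + total (λ u → δ v b * (h u * δ u a)) (allFin n)
      ≡⟨ cong₂ _+_ (scaled (δ v a) b) (scaled (δ v b) a) ⟩
    δ v a * h b + δ v b * h a ∎
    where
    open ≡-Reasoning
    scaled : ∀ c b → total (λ u → c * (h u * δ u b)) (allFin n) ≡ c * h b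
    scaled c b = trans (total-* c (λ u → h u * δ u b) (allFin n))
      (cong (c *_) (total-δ h b (Uniqueₚ.allFin⁺ n) (∈-allFin b)))

  -- A sum in place of a search: symmetry is immediate, and in a simple list at most one entry
  -- contributes.
  matrix : List WEdge → Fin n → Fin n → ℕ
  matrix X u v = total (λ (e , k) → mult u v e * k) X

  -- Double counting: a sum along row `v` is turned into a sum over edges. It serves both for
  -- degrees into a set and for the sums `σ`.
  total-matrix : ∀ h v X → total (λ u → h u * matrix X v u) (allFin n) ≡
    total (λ ((a , b) , k) → (δ v a * h b + δ v b * h a) * k) X
  total-matrix h v [] = total-zero {xs = allFin n} (All.tabulate λ {u} _ → ℕₚ.*-zeroʳ (h u))
  total-matrix h v (((a , b) , k) ∷ X) = begin
    total (λ u → h u * (mult v u (a , b) * k + matrix X v u)) (allFin n)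
      ≡⟨ total-cong (λ u → solve 4 (λ h m k r → h :* (m :* k :+ r) := k :* (h :* m) :+ h :* r) refl
           (h u) (mult v u (a , b)) k (matrix X v u)) (allFin n) ⟩
    total (λ u → k * (h u * mult v u (a , b)) + h u * matrix X v u) (allFin n)
      ≡⟨ total-+ (λ u → k * (h u * mult v u (a , b))) (λ u → h u * matrix X v u) (allFin n) ⟩
    total (λ u → k * (h u * mult v u (a , b))) (allFin n) + total (λ u → h u * matrix X v u) (allFin n)
      ≡⟨ cong₂ _+_ (trans (total-* k (λ u → h u * mult v u (a , b)) (allFin n))
           (trans (cong (k *_) (total-mult h v a b)) (ℕₚ.*-comm k _))) (total-matrix h v X) ⟩
    total (λ ((a , b) , k) → (δ v a * h b + δ v b * h a) * k) (((a , b) , k) ∷ X) ∎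
    where open ≡-Reasoning

  matrix-apart : ∀ X a b → All (Apart (a , b)) (edges X) → matrix X a b ≡ 0
  matrix-apart []            a b []         = refl
  matrix-apart ((f , k) ∷ X) a b (ap ∷ aps) rewrite mult-apart a b f ap = matrix-apart X a b aps

  matrix-∈ : ∀ X {a b k} → Simple (edges X) → ((a , b) , k) ∈ X → matrix X a b ≡ k
  matrix-∈ (_ ∷ X) {a} {b} {k} (a≢b , aps , _) (here refl)
    rewrite mult-self a≢b | matrix-apart X a b aps = trans (+-identityʳ _) (+-identityʳ k)
  matrix-∈ ((f , j) ∷ X) {a} {b} (_ , aps , s) (there i)
    rewrite mult-apart a b f (Apart-sym f (a , b) (All.lookup aps (∈-map⁺ proj₁ i))) = matrix-∈ X s i

  matrix-sym : ∀ X u v → matrix X u v ≡ matrix X v u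
  matrix-sym X u v = total-cong (λ (e , k) → cong (_* k) (mult-sym u v e)) X

  _∈±_ : Edge → List Edge → Set
  (a , b) ∈± E = (a , b) ∈ E ⊎ (b , a) ∈ E

  ∈±-there : ∀ {e f E} → e ∈± E → e ∈± (f ∷ E)
  ∈±-there (inj₁ i) = inj₁ (there i)
  ∈±-there (inj₂ i) = inj₂ (there i)

  ∈-≈ : ∀ {E F} → E ≈ F → ∀ {e} → e ∈ E → e ∈± F
  ∈-≈ (keep e p) (here refl)         = inj₁ (here refl)
  ∈-≈ (keep e p) (there i)           = ∈±-there (∈-≈ p i)
  ∈-≈ flip       (here refl)         = inj₂ (here refl)
  ∈-≈ flip       (there i)           = inj₁ (there i)
  ∈-≈ swap       (here refl)         = inj₁ (there (here refl))
  ∈-≈ swap       (there (here refl)) = inj₁ (here refl)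
  ∈-≈ swap       (there (there i))   = inj₁ (there (there i))
  ∈-≈ (≈-trans p q) i with ∈-≈ p i
  ... | inj₁ j = ∈-≈ q j
  ... | inj₂ j with ∈-≈ q j
  ...   | inj₁ k = inj₂ k
  ...   | inj₂ k = inj₁ k

  weight-injective : ∀ {X e f k} → Unique (weights X) → (e , k) ∈ X → (f , k) ∈ X → e ≡ f
  weight-injective u       (here refl) (here refl) = refl
  weight-injective (k∉ ∷ _) (here refl) (there j)  = contradiction refl (All.lookup k∉ (∈-map⁺ proj₂ j))
  weight-injective (k∉ ∷ _) (there i) (here refl)  = contradiction refl (All.lookup k∉ (∈-map⁺ proj₂ i))
  weight-injective (_ ∷ u) (there i)   (there j)   = weight-injective u i j

  -- With the smaller vertex first, different pairs cannot be reversals of each other, so they share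
  -- at most one vertex.
  ordered-apart : ∀ {a b c d : Fin n} → a Fin.< b → c Fin.< d → (a , b) ≢ (c , d) → Apart (a , b) (c , d)
  ordered-apart {a} {b} {c} {d} a<b c<d ne with a ≟ c
  ... | yes refl
    rewrite δ-≢ {a} {d} (Finₚ.<⇒≢ c<d) | δ-≢ {b} {a} (Finₚ.<⇒≢ a<b ∘ sym) | δ-≢ {b} {d} (λ { refl → ne refl }) = ≤-refl
  ... | no  _ with a ≟ d
  ...   | yes refl rewrite δ-≢ {b} {c} (Finₚ.<⇒≢ (Finₚ.<-trans c<d a<b) ∘ sym) | δ-≢ {b} {a} (Finₚ.<⇒≢ a<b ∘ sym) = ≤-refl
  ...   | no  _ with b ≟ c
  ...     | yes refl rewrite δ-≢ {b} {d} (Finₚ.<⇒≢ c<d) = ≤-refl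
  ...     | no  _ with b ≟ d
  ...       | yes _ = ≤-refl
  ...       | no  _ = z≤n

  ordered-simple : ∀ {E} → Unique E → All (λ (a , b) → a Fin.< b) E → Simple E
  ordered-simple []       []       = tt
  ordered-simple (e∉ ∷ u) (lt ∷ lts) =
    Finₚ.<⇒≢ lt , All.zipWith (λ (lt′ , ne) → ordered-apart lt lt′ ne) (lts , e∉) , ordered-simple u lts

-- The edge list of a graph.

module _ (G : Graph) where

  private
    N : ℕ
    N = order G

  forward : Edge {N} → Bool
  forward (u , v) = does (u <? v) ∧ adj G u v

  edgeList : List (Edge {N})
  edgeList = filter (λ e → T? (forward e)) (cartesianProduct (allFin N) (allFin N))

  length-edgeList : length edgeList ≡ numEdges G
  length-edgeList = rows (allFin N)
    where
    row : ∀ u vs → length (filter (λ e → T? (forward e)) (map (u ,_) vs)) ≡ total (λ v → if forward (u , v) then 1 else 0) vs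
    row u []       = refl
    row u (v ∷ vs) with forward (u , v)
    ... | true  = cong suc (row u vs)
    ... | false = row u vs
    rows : ∀ us → length (filter (λ e → T? (forward e)) (cartesianProduct us (allFin N))) ≡
      total (λ u → countFin N (λ v → forward (u , v))) us
    rows []       = refl
    rows (u ∷ us) = trans (cong length (filter-++ (λ e → T? (forward e)) (map (u ,_) (allFin N)) _))
      (trans (length-++ (filter (λ e → T? (forward e)) (map (u ,_) (allFin N)))) (cong₂ _+_ (row u (allFin N)) (rows us)))

  forward⁻ : ∀ {u v} → T (forward (u , v)) → u Fin.< v × T (adj G u v)
  forward⁻ {u} {v} t = let t₁ , t₂ = T-∧⁻ (does (u <? v)) t in does⁻ (u <? v) (T⇒≡ (does (u <? v)) t₁) , t₂

  edgeList-forward : All (T ∘ forward) edgeList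
  edgeList-forward = Allₚ.all-filter (λ e → T? (forward e)) (cartesianProduct (allFin N) (allFin N))

  edgeList-adj : All (λ (u , v) → T (adj G u v)) edgeList
  edgeList-adj = All.map (proj₂ ∘ forward⁻) edgeList-forward

  edgeList-simple : Simple edgeList
  edgeList-simple = ordered-simple
    (Uniqueₚ.filter⁺ (λ e → T? (forward e)) (Uniqueₚ.cartesianProduct⁺ (Uniqueₚ.allFin⁺ N) (Uniqueₚ.allFin⁺ N)))
    (All.map (proj₁ ∘ forward⁻) edgeList-forward)

  adj-flip : ∀ {u v} → T (adj G u v) → T (adj G v u)
  adj-flip {u} {v} = subst T (adj-sym G u v)

  forward-∈ : ∀ {u v} → u Fin.< v → T (adj G u v) → (u , v) ∈ edgeList
  forward-∈ {u} {v} lt t = ∈-filter⁺ (λ e → T? (forward e)) (∈-cartesianProduct⁺ (∈-allFin u) (∈-allFin v))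
    (subst (λ b → T (b ∧ adj G u v)) (sym (dec-true (u <? v) lt)) t)

  adj-∈± : ∀ {u v} → T (adj G u v) → (u , v) ∈± edgeList
  adj-∈± {u} {v} t with Finₚ.<-cmp u v
  ... | tri< lt _ _   = inj₁ (forward-∈ lt t)
  ... | tri> _ _ gt   = inj₂ (forward-∈ gt (adj-flip t))
  ... | tri≈ _ refl _ = ⊥-elim (subst T (irrefl G u) t)

  -- Two edges joining `v` and `u` would be parallel, which simplicity excludes.
  total-mult≤ : ∀ E v u → Simple E → All (λ (a , b) → T (adj G a b)) E →
    total (mult v u) E ≤ (if adj G v u then 1 else 0)
  total-mult≤ []            v u s             as       = z≤n
  total-mult≤ ((a , b) ∷ E) v u (a≢b , aps , s) (t ∷ as) with 1 ≤? mult v u (a , b)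
  ... | no lt rewrite n<1⇒n≡0 (≰⇒> lt) = total-mult≤ E v u s as
  ... | yes le with mult-pos v u a b le
  ...   | inj₁ (refl , refl) = bound a b a≢b t aps
    where
    bound : ∀ a b → a ≢ b → T (adj G a b) → All (Apart (a , b)) E →
      mult a b (a , b) + total (mult a b) E ≤ (if adj G a b then 1 else 0)
    bound a b a≢b t aps with adj G a b
    ... | true rewrite mult-self a≢b | total-zero (All.map (λ {f} → mult-apart a b f) aps) = ≤-refl
  ...   | inj₂ (refl , refl) with adj G b a | adj-flip t
  ...     | true | _ rewrite mult-sym b a (a , b) | mult-self a≢b
            | total-cong (mult-sym b a) E | total-zero (All.map (λ {f} → mult-apart a b f) aps) = ≤-refl

  -- The hypothesis is applied to the subgraph induced by `S`.
  edgeList-degenerate : TwoDegenerate G → Degenerate edgeList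
  edgeList-degenerate td S (v₀ , Sv₀) with td K (v₀ , subst T (sym Sv₀) tt)
    where
    K : Subgraph G
    K = record
      { S      = S
      ; H      = λ u v → S u ∧ (S v ∧ adj G u v)
      ; H-sym  = λ u v → trans (cong (λ b → S u ∧ (S v ∧ b)) (adj-sym G u v)) (swap-∧ (S u) (S v) (adj G v u))
      ; H⊆E    = λ u v t → proj₂ (T-∧⁻ (S v) (proj₂ (T-∧⁻ (S u) t)))
      ; H-ends = λ u v t → proj₁ (T-∧⁻ (S u) t) , proj₁ (T-∧⁻ (S v) (proj₂ (T-∧⁻ (S u) t)))
      }
      where
      swap-∧ : ∀ a b c → a ∧ (b ∧ c) ≡ b ∧ (a ∧ c)
      swap-∧ true  true  c = refl
      swap-∧ true  false c = refl
      swap-∧ false true  c = refl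
      swap-∧ false false c = refl
  ... | v , Sv , le = v , T⇒≡ (S v) Sv , ≤-trans bound le
    where
    -- With unit weights, double counting rewrites the degree into `S` as a sum over the possible
    -- neighbours.
    weighted : List (WEdge {N})
    weighted = map (_, 1) edgeList
    total-weighted : ∀ (g : Edge → ℕ) E → total (λ (e , k) → g e * k) (map (_, 1) E) ≡ total g E
    total-weighted g []      = refl
    total-weighted g (e ∷ E) = cong₂ _+_ (ℕₚ.*-identityʳ (g e)) (total-weighted g E)
    open ℕₚ.≤-Reasoning
    count : ∀ s t m c → s ≡ true → m ≤ (if c then 1 else 0) → (if t then 1 else 0) * m ≤ (if s ∧ (t ∧ c) then 1 else 0)
    count true true  m c refl le = subst (_≤ (if c then 1 else 0)) (sym (+-identityʳ m)) le
    count true false m c refl le = z≤n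
    bound : degIn S edgeList v ≤ countFin N (λ u → S v ∧ (S u ∧ adj G v u))
    bound = begin
      degIn S edgeList v
        ≡⟨ total-cong (λ (a , b) → cong₂ _+_ (trans (if-* (S b) (δ v a)) (ℕₚ.*-comm _ (δ v a)))
                                             (trans (if-* (S a) (δ v b)) (ℕₚ.*-comm _ (δ v b)))) edgeList ⟩
      total (λ (a , b) → δ v a * (if S b then 1 else 0) + δ v b * (if S a then 1 else 0)) edgeList
        ≡⟨ total-weighted (λ (a , b) → δ v a * (if S b then 1 else 0) + δ v b * (if S a then 1 else 0)) edgeList ⟨
      total (λ ((a , b) , k) → (δ v a * (if S b then 1 else 0) + δ v b * (if S a then 1 else 0)) * k) weighted
        ≡⟨ total-matrix (λ u → if S u then 1 else 0) v weighted ⟨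
      total (λ u → (if S u then 1 else 0) * matrix weighted v u) (allFin N)
        ≤⟨ total-mono (λ u → count (S v) (S u) (matrix weighted v u) (adj G v u) (T⇒≡ (S v) Sv)
             (≤-trans (≤-reflexive (total-weighted (mult v u) edgeList))
               (total-mult≤ edgeList v u edgeList-simple edgeList-adj))) (allFin N) ⟩
      countFin N (λ u → S v ∧ (S u ∧ adj G v u)) ∎

  -- Reading off the weighting from a solution.

  module _ {W : List ℕ} (X : List (WEdge {N})) (Fr : List ℕ) (X≈ : edges X ≈ edgeList)
           (π : weights X ++ Fr ↭ W) (oks : All (OK X) (edges X)) (unique : Unique W) (nice : Nice G) where

    private
      simple : Simple (edges X)
      simple = Simple-≈ (≈-sym X≈) edgeList-simple

      adjacent : All (λ (u , v) → T (adj G u v)) (edges X)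
      adjacent = All-≈ adj-flip (≈-sym X≈) edgeList-adj

    record Entry (u v : Fin N) : Set where
      constructor entry
      field
        edge    : Edge
        label   : ℕ
        present : (edge , label) ∈ X
        value   : matrix X u v ≡ label
        ends    : edge ≡ (u , v) ⊎ edge ≡ (v , u)

    lookup-edge : ∀ {u v} → (u , v) ∈± edges X → Entry u v
    lookup-edge {u} {v} (inj₁ i) with (e , k) , j , refl ← ∈-map⁻ proj₁ i = entry e k j (matrix-∈ X simple j) (inj₁ refl)
    lookup-edge {u} {v} (inj₂ i) with (e , k) , j , refl ← ∈-map⁻ proj₁ i =
      entry e k j (trans (matrix-sym X u v) (matrix-∈ X simple j)) (inj₂ refl)

    find : ∀ {u v} → T (adj G u v) → Entry u v
    find {u} {v} t with adj-∈± t
    ... | inj₁ i = lookup-edge (∈-≈ (≈-sym X≈) i)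
    ... | inj₂ i with ∈-≈ (≈-sym X≈) i
    ...   | inj₁ j = lookup-edge (inj₂ j)
    ...   | inj₂ j = lookup-edge (inj₁ j)

    -- Double counting with the adjacency indicator, which is 1 on every edge of `X`.
    σ-load : ∀ v → σ G (matrix X) v ≡ load X v
    σ-load v = begin
      σ G (matrix X) v
        ≡⟨ total-cong (λ u → if-* (adj G v u) (matrix X v u)) (allFin N) ⟩
      total (λ u → (if adj G v u then 1 else 0) * matrix X v u) (allFin N)
        ≡⟨ total-matrix (λ u → if adj G v u then 1 else 0) v X ⟩
      total (λ ((a , b) , k) → (δ v a * (if adj G v b then 1 else 0) + δ v b * (if adj G v a then 1 else 0)) * k) X
        ≡⟨ total-cong-∈ (All.map (λ { {(a , b) , k} t → cong (_* k) (cong₂ _+_ (at t) (at (adj-flip t))) }) (Allₚ.map⁻ adjacent)) ⟩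
      load X v ∎
      where
      open ≡-Reasoning
      at : ∀ {a b} → T (adj G a b) → δ v a * (if adj G v b then 1 else 0) ≡ δ v a
      at {a} {b} t with v ≟ a
      ... | no  _    = refl
      ... | yes refl with adj G v b
      ...   | true = refl

    same-ends : ∀ {u v x y : Fin N} {e} → e ≡ (u , v) ⊎ e ≡ (v , u) → e ≡ (x , y) ⊎ e ≡ (y , x) →
      (u ≡ x × v ≡ y) ⊎ (u ≡ y × v ≡ x)
    same-ends (inj₁ refl) (inj₁ refl) = inj₁ (refl , refl)
    same-ends (inj₁ refl) (inj₂ refl) = inj₂ (refl , refl)
    same-ends (inj₂ refl) (inj₁ refl) = inj₂ (refl , refl)
    same-ends (inj₂ refl) (inj₂ refl) = inj₁ (refl , refl)

    inc-ends : ∀ {u v : Fin N} {e} → e ≡ (u , v) ⊎ e ≡ (v , u) → 1 ≤ inc u e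
    inc-ends {u} {v} (inj₁ refl) = incˡ u v
    inc-ends {u} {v} (inj₂ refl) = incʳ v u

    -- Degree one forces the edges from `u` to `x` and to `v` to be the same.
    only-neighbour : ∀ {u v} → T (adj G u v) → deg′ (edges X) u ≡ 1 → ∀ x → T (adj G u x) → x ≡ v
    only-neighbour {u} {v} t d x t′
      with entry e k i _ ends ← find t | entry e′ k′ i′ _ ends′ ← find t′
      with refl ← total-unique (inc u) (≤-reflexive d) (∈-map⁺ proj₁ i) (∈-map⁺ proj₁ i′) (inc-ends ends) (inc-ends ends′)
      with same-ends ends′ ends
    ... | inj₁ (_ , eq)     = eq
    ... | inj₂ (eq₁ , eq₂)  = trans eq₂ eq₁

    -- An exempt edge would form a K₂ component, which niceness rules out.
    distinguished : ∀ {a b} → T (adj G a b) → (a , b) ∈ edges X → load X a ≢ load X b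
    distinguished {a} {b} t i with All.lookup oks i
    ... | inj₁ ne        = ne
    ... | inj₂ (da , db) = ⊥-elim (nice (a , b , t , only-neighbour t da , only-neighbour (adj-flip t) db))

    goodWeighting : GoodWeighting G (_∈ W) (matrix X)
    goodWeighting = matrix-sym X , inside , injective , distinguishing
      where
      inside : WeightsIn G (matrix X) (_∈ W)
      inside u v t with entry _ k i eq _ ← find t =
        subst (_∈ W) (sym eq) (∈-resp-↭ π (∈-++⁺ˡ (∈-map⁺ proj₂ i)))
      injective : EdgeInjective G (matrix X)
      injective u v x y t t′ eq
        with entry e k i val ends ← find t | entry e′ k′ i′ val′ ends′ ← find t′
        with refl ← trans (sym val) (trans eq val′)
        with refl ← weight-injective {X = X} (Unique-++⁻ˡ (weights X) (Unique-resp-↭ (↭-sym π) unique)) i i′ =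
        same-ends ends ends′
      distinguishing : NeighbourSumDistinguishing G (matrix X)
      distinguishing u v t eq with entry e k i _ ends ← find t
        with load≡ ← trans (sym (σ-load u)) (trans eq (σ-load v))
        with ends
      ... | inj₁ refl = distinguished t (∈-map⁺ proj₁ i) load≡
      ... | inj₂ refl = distinguished (adj-flip t) (∈-map⁺ proj₁ i) (sym load≡)

  weighting-exists : Nice G → TwoDegenerate G → ∀ W → Unique W → length W ≡ numEdges G + 4 →
    ∃ λ w → GoodWeighting G (_∈ W) w
  weighting-exists nice td W u len
    with X , Fr , X≈ , π , oks ← solvable _ edgeList ≤-refl edgeList-simple (edgeList-degenerate td) W u
           (≤-reflexive (trans (cong (_+ 4) length-edgeList) (sym len))) =
    matrix X , goodWeighting X Fr X≈ π oks u nice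

theorem5p1 : (G : Graph) → Nice G → TwoDegenerate G →
    ((W : List ℕ) → Unique W → All (λ a → 0 < a) W → length W ≡ numEdges G + 4 →
    ∃ λ w → GoodWeighting G (λ a → a ∈ W) w)
    × (∃ λ w → GoodWeighting G (λ a → 1 ≤ a × a ≤ numEdges G + 4) w)
theorem5p1 G nice td = (λ W u _ len → weighting-exists G nice td W u len) , initial
  where
  m : ℕ
  m = numEdges G + 4
  initial : ∃ λ w → GoodWeighting G (λ a → 1 ≤ a × a ≤ m) w
  initial with w , isw , inside , rest ← weighting-exists G nice td (applyUpTo suc m)
                 (Uniqueₚ.applyUpTo⁺₁ suc m λ i<j _ eq → ℕₚ.<⇒≢ i<j (ℕₚ.suc-injective eq)) (length-applyUpTo suc m) =
    w , isw , (λ u v t → range (∈-applyUpTo⁻ suc (inside u v t))) , rest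
    where
    range : ∀ {a} → (∃ λ i → i < m × a ≡ suc i) → 1 ≤ a × a ≤ m
    range (i , i<m , refl) = s≤s z≤n , i<m
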